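{- No randomized online algorithm for the dicut model has a competitive ratio better than $4/5$, and no deterministic online algorithm for the dicut model has a competitive ratio better than $\frac{5-\sqrt{17}}{2}\approx 0.438$. Both statements hold even if the algorithm is given access to all arcs of $G$ (and their weights), including arcs leaving unrevealed elements.
   Context: The dicut model: there is a directed graph $G=(V,A)$ with non-negative arc weights, and an unknown ground set $\mathcal N=\{u_1,\dots,u_n\}\subseteq V$. The objective $f:2^{\mathcal N}\to\mathbb R_{\ge0}$ is the cut function: $f(S)$ is the total weight of arcs of $G$ going from a node of $S$ to a node of $V\setminus S$. The elements of $\mathcal N$ are revealed one by one in the order $u_1,\dots,u_n$, chosen by an adversary. The algorithm knows $V$, but does not know $\mathcal N$, $n$ or the revelation order in advance (so from its point of view the input might end after every element). At any time it can query the existence and weight of every arc leaving a node that has already been revealed. It maintains solutions $S_0=\varnothing,S_1,\dots,S_n$, where immediately after $u_i$ is revealed it chooses $S_i$ to be any subset of $S_{i-1}\cup\{u_i\}$, based only on the information available so far (and, for randomized algorithms, internal randomness). Every subset of $\mathcal N$ is feasible. The computational power of the algorithm is not restricted. The algorithm is $\alpha$-competitive (has competitive ratio at least $\alpha$) if $\mathbb E[f(S_n)]\ge\alpha\cdot\max_{S\subseteq\mathcal N}f(S)$ for every instance. The instance is fixed independently of the outcome of the algorithm's random choices, but may depend on the algorithm. -}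

module Defs where

open import Data.Bool.Base using (Bool; true; false; _∧_; _∨_; not; if_then_else_)
import Data.Bool.Properties as Bool
open import Data.Fin.Base using (Fin)
open import Data.Fin.Subset using (Subset; inside; outside; ⊥; ⊤; ⁅_⁆; _∪_; _⊆_)
open import Data.Fin.Subset.Properties using (_∈?_)
import Data.Integer.Base as ℤ
import Data.Integer.Properties as ℤ
open import Data.List.Base using (List; []; _∷_; _++_; map; foldr; allFin)
open import Data.List.Membership.Propositional using (_∈_)
open import Data.List.Relation.Unary.Unique.Propositional using (Unique)
open import Data.Maybe.Base using (Maybe; just; nothing)
open import Data.Nat.Base as ℕ using (ℕ; zero; suc)
import Data.Nat.Coprimality as ℕ
import Data.Nat.Properties as ℕ
open import Data.Product.Base using (∃-syntax; Σ-syntax; _×_; _,_; proj₁; proj₂)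
open import Data.Rational.Base as ℚ using (ℚ; mkℚ; 0ℚ; 1ℚ; ½; ∣_∣)
import Data.Rational.Properties as ℚ
import Data.Rational.Unnormalised.Base as ℚᵘ
import Data.Rational.Unnormalised.Properties as ℚᵘ
open import Data.Rational.Solver using (module +-*-Solver)
open import Data.Sum.Base using (_⊎_; inj₁; inj₂)
open import Data.Vec.Base using ([]; _∷_)
open import Data.Vec.Properties using (≡-dec)
open import Relation.Binary.Definitions using (DecidableEquality)
open import Relation.Binary.PropositionalEquality
open import Relation.Nullary.Decidable.Core using (does)

------------------------------------------------------------------------
-- Real numbers, as Cauchy sequences of rationals with an arbitrary
-- modulus of convergence; equality is _≈_, not _≡_.

IsCauchy : (ℕ → ℚ) → Set
IsCauchy x = ∀ ε → 0ℚ ℚ.< ε →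
  ∃[ N ] (∀ m n → N ℕ.≤ m → N ℕ.≤ n → ∣ x m ℚ.- x n ∣ ℚ.≤ ε)

record ℝ : Set where
  constructor mkℝ
  field
    seq    : ℕ → ℚ
    cauchy : IsCauchy seq

open ℝ public

infix  4 _≤_ _<_ _≈_
infixl 6 _+_ _-_ _⊔_
infixl 7 _*_

_≤_ : ℝ → ℝ → Set
x ≤ y = ∀ ε → 0ℚ ℚ.< ε → ∃[ N ] (∀ n → N ℕ.≤ n → seq x n ℚ.≤ seq y n ℚ.+ ε)

_<_ : ℝ → ℝ → Set
x < y = ∃[ ε ] (0ℚ ℚ.< ε × ∃[ N ] (∀ n → N ℕ.≤ n → seq x n ℚ.+ ε ℚ.≤ seq y n))

_≈_ : ℝ → ℝ → Set
x ≈ y = x ≤ y × y ≤ x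

private
  open +-*-Solver using (solve; _:=_; _:+_; _:*_; :-_; _:-_; con)

  half-pos : ∀ {ε} → 0ℚ ℚ.< ε → 0ℚ ℚ.< ½ ℚ.* ε
  half-pos {ε} h = subst (ℚ._< ½ ℚ.* ε) (ℚ.*-zeroʳ ½) (ℚ.*-monoʳ-<-pos ½ h)

  halves : ∀ ε → ½ ℚ.* ε ℚ.+ ½ ℚ.* ε ≡ ε
  halves ε = trans (sym (ℚ.*-distribʳ-+ ε ½ ½)) (ℚ.*-identityˡ ε)

  ∣-∣-lub : ∀ {p q} → p ℚ.≤ q → ℚ.- p ℚ.≤ q → ∣ p ∣ ℚ.≤ q
  ∣-∣-lub {p} h k with ℚ.∣p∣≡p∨∣p∣≡-p p
  ... | inj₁ e = subst (ℚ._≤ _) (sym e) h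
  ... | inj₂ e = subst (ℚ._≤ _) (sym e) k

  p≤∣p∣ : ∀ p → p ℚ.≤ ∣ p ∣
  p≤∣p∣ p with ℚ.≤-total 0ℚ p
  ... | inj₁ h = ℚ.≤-reflexive (sym (ℚ.0≤p⇒∣p∣≡p h))
  ... | inj₂ h = ℚ.≤-trans h (ℚ.0≤∣p∣ p)

  *-mono-nonNeg : ∀ {a b c d} → 0ℚ ℚ.≤ a → 0ℚ ℚ.≤ d → a ℚ.≤ b → c ℚ.≤ d →
                  a ℚ.* c ℚ.≤ b ℚ.* d
  *-mono-nonNeg {a} {b} {c} {d} 0≤a 0≤d a≤b c≤d = ℚ.≤-trans
    (ℚ.*-monoˡ-≤-nonNeg a {{ℚ.nonNegative 0≤a}} c≤d)
    (ℚ.*-monoʳ-≤-nonNeg d {{ℚ.nonNegative 0≤d}} a≤b)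

  0≤* : ∀ {a b} → 0ℚ ℚ.≤ a → 0ℚ ℚ.≤ b → 0ℚ ℚ.≤ a ℚ.* b
  0≤* {a} {b} ha hb =
    subst (ℚ._≤ a ℚ.* b) (ℚ.*-zeroʳ a) (ℚ.*-monoˡ-≤-nonNeg a {{ℚ.nonNegative ha}} hb)

  0≤b-a : ∀ {a b} → a ℚ.≤ b → 0ℚ ℚ.≤ b ℚ.- a
  0≤b-a {a} {b} h = subst (ℚ._≤ b ℚ.- a) (ℚ.+-inverseʳ a) (ℚ.+-monoˡ-≤ (ℚ.- a) h)

  a≤b : ∀ {a b} → 0ℚ ℚ.≤ b ℚ.- a → a ℚ.≤ b
  a≤b {a} {b} h = subst₂ ℚ._≤_ (ℚ.+-identityʳ a)
    (solve 2 (λ x y → x :+ (y :- x) := y) refl a b) (ℚ.+-monoʳ-≤ a h)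

fromℚ : ℚ → ℝ
fromℚ q = mkℝ (λ _ → q) λ ε 0<ε → 0 , λ _ _ _ _ →
  subst (λ p → ∣ p ∣ ℚ.≤ ε) (sym (ℚ.+-inverseʳ q)) (ℚ.<⇒≤ 0<ε)

0ℝ 1ℝ : ℝ
0ℝ = fromℚ 0ℚ
1ℝ = fromℚ 1ℚ

_+_ : ℝ → ℝ → ℝ
x + y = mkℝ (λ n → seq x n ℚ.+ seq y n) λ ε 0<ε →
  let (M , hx) = cauchy x (½ ℚ.* ε) (half-pos 0<ε)
      (N , hy) = cauchy y (½ ℚ.* ε) (half-pos 0<ε)
  in M ℕ.⊔ N , λ m n p q → bound ε (seq x m) (seq y m) (seq x n) (seq y n)
       (hx m n (ℕ.m⊔n≤o⇒m≤o M N p) (ℕ.m⊔n≤o⇒m≤o M N q))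
       (hy m n (ℕ.m⊔n≤o⇒n≤o M N p) (ℕ.m⊔n≤o⇒n≤o M N q))
  where
  bound : ∀ ε a b c d → ∣ a ℚ.- c ∣ ℚ.≤ ½ ℚ.* ε → ∣ b ℚ.- d ∣ ℚ.≤ ½ ℚ.* ε →
          ∣ (a ℚ.+ b) ℚ.- (c ℚ.+ d) ∣ ℚ.≤ ε
  bound ε a b c d h k = begin
    ∣ (a ℚ.+ b) ℚ.- (c ℚ.+ d) ∣
      ≡⟨ cong ∣_∣ (solve 4 (λ a b c d → (a :+ b) :- (c :+ d) := (a :- c) :+ (b :- d))
                   refl a b c d) ⟩
    ∣ (a ℚ.- c) ℚ.+ (b ℚ.- d) ∣
      ≤⟨ ℚ.∣p+q∣≤∣p∣+∣q∣ (a ℚ.- c) (b ℚ.- d) ⟩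
    ∣ a ℚ.- c ∣ ℚ.+ ∣ b ℚ.- d ∣
      ≤⟨ ℚ.+-mono-≤ h k ⟩
    ½ ℚ.* ε ℚ.+ ½ ℚ.* ε
      ≡⟨ halves ε ⟩
    ε ∎
    where open ℚ.≤-Reasoning

private
  eventuallyBounded : ∀ x → ∃[ K ] (0ℚ ℚ.< K × ∃[ N ] (∀ n → N ℕ.≤ n → ∣ seq x n ∣ ℚ.≤ K))
  eventuallyBounded x with cauchy x 1ℚ (ℚ.positive⁻¹ 1ℚ)
  ... | N , h = ∣ seq x N ∣ ℚ.+ 1ℚ
              , ℚ.+-mono-≤-< (ℚ.0≤∣p∣ (seq x N)) (ℚ.positive⁻¹ 1ℚ)
              , N , λ n p → bound (seq x N) (seq x n) (h n N p ℕ.≤-refl)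
    where
    bound : ∀ a b → ∣ b ℚ.- a ∣ ℚ.≤ 1ℚ → ∣ b ∣ ℚ.≤ ∣ a ∣ ℚ.+ 1ℚ
    bound a b h = begin
      ∣ b ∣
        ≡⟨ cong ∣_∣ (solve 2 (λ a b → b := a :+ (b :- a)) refl a b) ⟩
      ∣ a ℚ.+ (b ℚ.- a) ∣        ≤⟨ ℚ.∣p+q∣≤∣p∣+∣q∣ a (b ℚ.- a) ⟩
      ∣ a ∣ ℚ.+ ∣ b ℚ.- a ∣      ≤⟨ ℚ.+-monoʳ-≤ ∣ a ∣ h ⟩
      ∣ a ∣ ℚ.+ 1ℚ               ∎
      where open ℚ.≤-Reasoning

  quotient : ∀ p ε → 0ℚ ℚ.< p → 0ℚ ℚ.< ε → ∃[ δ ] (0ℚ ℚ.< δ × p ℚ.* δ ≡ ε)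
  quotient p ε 0<p 0<ε = δ , 0<δ , pδ≡ε
    where
    p-nz : ℚ.NonZero p
    p-nz = ℚ.pos⇒nonZero p {{ℚ.positive 0<p}}

    δ : ℚ
    δ = (ℚ.1/_ p {{p-nz}}) ℚ.* ε

    pδ≡ε : p ℚ.* δ ≡ ε
    pδ≡ε = trans (sym (ℚ.*-assoc p (ℚ.1/_ p {{p-nz}}) ε))
             (trans (cong (ℚ._* ε) (ℚ.*-inverseʳ p {{p-nz}})) (ℚ.*-identityˡ ε))

    0<δ : 0ℚ ℚ.< δ
    0<δ = ℚ.*-cancelˡ-<-nonNeg p {{ℚ.nonNegative (ℚ.<⇒≤ 0<p)}}
            (subst₂ ℚ._<_ (sym (ℚ.*-zeroʳ p)) (sym pδ≡ε) 0<ε)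

  0<+ : ∀ {p q} → 0ℚ ℚ.< p → 0ℚ ℚ.< q → 0ℚ ℚ.< p ℚ.+ q
  0<+ {p} {q} h k = subst (ℚ._< p ℚ.+ q) (ℚ.+-identityˡ 0ℚ) (ℚ.+-mono-< h k)

  product-bound : ∀ {K L δ ε} a b c d → 0ℚ ℚ.≤ δ → (K ℚ.+ L) ℚ.* δ ≡ ε →
                  ∣ a ∣ ℚ.≤ K → ∣ d ∣ ℚ.≤ L →
                  ∣ a ℚ.- c ∣ ℚ.≤ δ → ∣ b ℚ.- d ∣ ℚ.≤ δ →
                  ∣ a ℚ.* b ℚ.- c ℚ.* d ∣ ℚ.≤ ε
  product-bound {K} {L} {δ} {ε} a b c d 0≤δ eq ha hd hac hbd = begin
    ∣ a ℚ.* b ℚ.- c ℚ.* d ∣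
      ≡⟨ cong ∣_∣ (solve 4 (λ a b c d → a :* b :- c :* d :=
                                         a :* (b :- d) :+ d :* (a :- c)) refl a b c d) ⟩
    ∣ a ℚ.* (b ℚ.- d) ℚ.+ d ℚ.* (a ℚ.- c) ∣
      ≤⟨ ℚ.∣p+q∣≤∣p∣+∣q∣ (a ℚ.* (b ℚ.- d)) (d ℚ.* (a ℚ.- c)) ⟩
    ∣ a ℚ.* (b ℚ.- d) ∣ ℚ.+ ∣ d ℚ.* (a ℚ.- c) ∣
      ≡⟨ cong₂ ℚ._+_ (ℚ.∣p*q∣≡∣p∣*∣q∣ a (b ℚ.- d)) (ℚ.∣p*q∣≡∣p∣*∣q∣ d (a ℚ.- c)) ⟩
    ∣ a ∣ ℚ.* ∣ b ℚ.- d ∣ ℚ.+ ∣ d ∣ ℚ.* ∣ a ℚ.- c ∣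
      ≤⟨ ℚ.+-mono-≤ (*-mono-nonNeg (ℚ.0≤∣p∣ a) 0≤δ ha hbd)
                    (*-mono-nonNeg (ℚ.0≤∣p∣ d) 0≤δ hd hac) ⟩
    K ℚ.* δ ℚ.+ L ℚ.* δ
      ≡⟨ sym (ℚ.*-distribʳ-+ δ K L) ⟩
    (K ℚ.+ L) ℚ.* δ
      ≡⟨ eq ⟩
    ε ∎
    where open ℚ.≤-Reasoning

  *-cauchy : ∀ x y → IsCauchy (λ n → seq x n ℚ.* seq y n)
  *-cauchy x y ε 0<ε =
    let (K , 0<K , N₁ , hK) = eventuallyBounded x
        (L , 0<L , N₂ , hL) = eventuallyBounded y
        (δ , 0<δ , eq)      = quotient (K ℚ.+ L) ε (0<+ 0<K 0<L) 0<ε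
        (N₃ , hx)           = cauchy x δ 0<δ
        (N₄ , hy)           = cauchy y δ 0<δ
    in (N₁ ℕ.⊔ N₂) ℕ.⊔ (N₃ ℕ.⊔ N₄) , λ m n p q →
      let p₁ = ℕ.m⊔n≤o⇒m≤o (N₁ ℕ.⊔ N₂) (N₃ ℕ.⊔ N₄) p
          p₂ = ℕ.m⊔n≤o⇒n≤o (N₁ ℕ.⊔ N₂) (N₃ ℕ.⊔ N₄) p
          q₁ = ℕ.m⊔n≤o⇒m≤o (N₁ ℕ.⊔ N₂) (N₃ ℕ.⊔ N₄) q
          q₂ = ℕ.m⊔n≤o⇒n≤o (N₁ ℕ.⊔ N₂) (N₃ ℕ.⊔ N₄) q
      in product-bound (seq x m) (seq y m) (seq x n) (seq y n) (ℚ.<⇒≤ 0<δ) eq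
           (hK m (ℕ.m⊔n≤o⇒m≤o N₁ N₂ p₁)) (hL n (ℕ.m⊔n≤o⇒n≤o N₁ N₂ q₁))
           (hx m n (ℕ.m⊔n≤o⇒m≤o N₃ N₄ p₂) (ℕ.m⊔n≤o⇒m≤o N₃ N₄ q₂))
           (hy m n (ℕ.m⊔n≤o⇒n≤o N₃ N₄ p₂) (ℕ.m⊔n≤o⇒n≤o N₃ N₄ q₂))

_*_ : ℝ → ℝ → ℝ
x * y = mkℝ (λ n → seq x n ℚ.* seq y n) (*-cauchy x y)

_-_ : ℝ → ℝ → ℝ
x - y = x + fromℚ (ℚ.- 1ℚ) * y

_⊔_ : ℝ → ℝ → ℝ
x ⊔ y = mkℝ (λ n → seq x n ℚ.⊔ seq y n) λ ε 0<ε →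
  let (M , hx) = cauchy x ε 0<ε
      (N , hy) = cauchy y ε 0<ε
  in M ℕ.⊔ N , λ m n p q →
       let hx′ = λ i j r s → diff≤ (seq x i) (seq x j) (hx i j (ℕ.m⊔n≤o⇒m≤o M N r) (ℕ.m⊔n≤o⇒m≤o M N s))
           hy′ = λ i j r s → diff≤ (seq y i) (seq y j) (hy i j (ℕ.m⊔n≤o⇒n≤o M N r) (ℕ.m⊔n≤o⇒n≤o M N s))
       in ∣-∣-lub (half (seq x m) (seq y m) (seq x n) (seq y n) (hx′ m n p q) (hy′ m n p q))
            (subst (ℚ._≤ ε)
              (solve 2 (λ a b → b :- a := :- (a :- b)) refl
                (seq x m ℚ.⊔ seq y m) (seq x n ℚ.⊔ seq y n))
              (half (seq x n) (seq y n) (seq x m) (seq y m) (hx′ n m q p) (hy′ n m q p)))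
  where
  diff≤ : ∀ {ε} a b → ∣ a ℚ.- b ∣ ℚ.≤ ε → a ℚ.≤ b ℚ.+ ε
  diff≤ {ε} a b h = subst (ℚ._≤ b ℚ.+ ε) (solve 2 (λ a b → b :+ (a :- b) := a) refl a b)
    (ℚ.+-monoʳ-≤ b (ℚ.≤-trans (p≤∣p∣ (a ℚ.- b)) h))

  half : ∀ {ε} a b c d → a ℚ.≤ c ℚ.+ ε → b ℚ.≤ d ℚ.+ ε → (a ℚ.⊔ b) ℚ.- (c ℚ.⊔ d) ℚ.≤ ε
  half {ε} a b c d h k = subst (a ℚ.⊔ b ℚ.- (c ℚ.⊔ d) ℚ.≤_)
    (solve 2 (λ e t → (t :+ e) :- t := e) refl ε (c ℚ.⊔ d))
    (ℚ.+-monoˡ-≤ (ℚ.- (c ℚ.⊔ d))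
      (ℚ.⊔-lub (ℚ.≤-trans h (ℚ.+-monoˡ-≤ ε (ℚ.p≤p⊔q c d)))
               (ℚ.≤-trans k (ℚ.+-monoˡ-≤ ε (ℚ.p≤q⊔p c d)))))

ℝ≥0 : Set
ℝ≥0 = Σ[ x ∈ ℝ ] 0ℝ ≤ x

sum : List ℝ → ℝ
sum = foldr _+_ 0ℝ

------------------------------------------------------------------------
-- √17 is the limit of the iteration x ↦ x + (17 - x²) / 8 from 4, which
-- maps [4,5] to itself and at least halves distances there.

private
  q4 q5 q17 ⅛ : ℚ
  q4  = ℤ.+ 4 ℚ./ 1
  q5  = ℤ.+ 5 ℚ./ 1
  q17 = ℤ.+ 17 ℚ./ 1
  ⅛   = ℤ.+ 1 ℚ./ 8

  step : ℚ → ℚ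
  step x = x ℚ.+ ⅛ ℚ.* (q17 ℚ.- x ℚ.* x)

  approx : ℕ → ℚ
  approx zero    = q4
  approx (suc n) = step (approx n)

  In : ℚ → Set
  In x = q4 ℚ.≤ x × x ℚ.≤ q5

  3≤4 : ℤ.+ 3 ℚ./ 1 ℚ.≤ q4
  3≤4 = ℚ.≤ᵇ⇒≤ _

  step-In : ∀ {x} → In x → In (step x)
  step-In {x} (lo , hi) =
      a≤b (subst (0ℚ ℚ.≤_)
        (solve 1 (λ x → con ⅛ :* ((x :- con (ℤ.+ 3 ℚ./ 1)) :* (con q5 :- x))
                     := (x :+ con ⅛ :* (con q17 :- x :* x)) :- con q4) refl x)
        (0≤* {⅛} (ℚ.nonNegative⁻¹ ⅛)
          (0≤* (0≤b-a (ℚ.≤-trans 3≤4 lo)) (0≤b-a hi))))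
    , a≤b (subst (0ℚ ℚ.≤_)
        (solve 1 (λ x → con ⅛ :* ((x :- con q4) :* (x :- con q4) :+ con (ℤ.+ 7 ℚ./ 1))
                     := con q5 :- (x :+ con ⅛ :* (con q17 :- x :* x))) refl x)
        (0≤* {⅛} (ℚ.nonNegative⁻¹ ⅛)
          (ℚ.+-mono-≤ {0ℚ} {_} {0ℚ} (0≤* (0≤b-a lo) (0≤b-a lo))
            (ℚ.nonNegative⁻¹ (ℤ.+ 7 ℚ./ 1)))))

  approx-In : ∀ n → In (approx n)
  approx-In zero    = ℚ.≤-refl , ℚ.≤ᵇ⇒≤ _
  approx-In (suc n) = step-In (approx-In n)

  step-contracts : ∀ {x y} → In x → In y →
                   ∣ step x ℚ.- step y ∣ ℚ.≤ ½ ℚ.* ∣ x ℚ.- y ∣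
  step-contracts {x} {y} (xl , xh) (yl , yh) = begin
    ∣ step x ℚ.- step y ∣
      ≡⟨ cong ∣_∣ (solve 2 (λ x y →
           (x :+ con ⅛ :* (con q17 :- x :* x)) :- (y :+ con ⅛ :* (con q17 :- y :* y))
           := (con 1ℚ :- con ⅛ :* (x :+ y)) :* (x :- y)) refl x y) ⟩
    ∣ c ℚ.* (x ℚ.- y) ∣
      ≡⟨ ℚ.∣p*q∣≡∣p∣*∣q∣ c (x ℚ.- y) ⟩
    ∣ c ∣ ℚ.* ∣ x ℚ.- y ∣
      ≤⟨ *-mono-nonNeg (ℚ.0≤∣p∣ c) (ℚ.0≤∣p∣ (x ℚ.- y)) ∣c∣≤½ ℚ.≤-refl ⟩
    ½ ℚ.* ∣ x ℚ.- y ∣ ∎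
    where
    open ℚ.≤-Reasoning
    c : ℚ
    c = 1ℚ ℚ.- ⅛ ℚ.* (x ℚ.+ y)

    ∣c∣≤½ : ∣ c ∣ ℚ.≤ ½
    ∣c∣≤½ = ∣-∣-lub
      (a≤b (subst (0ℚ ℚ.≤_)
        (solve 2 (λ x y → con ⅛ :* ((x :- con q4) :+ (y :- con q4)) :+ con ½
                       := con ½ :- (con 1ℚ :- con ⅛ :* (x :+ y))) refl x y)
        (ℚ.+-mono-≤ {0ℚ} {_} {0ℚ}
          (0≤* {⅛} (ℚ.nonNegative⁻¹ ⅛) (ℚ.+-mono-≤ {0ℚ} {_} {0ℚ} (0≤b-a xl) (0≤b-a yl)))
          (ℚ.nonNegative⁻¹ ½))))
      (a≤b (subst (0ℚ ℚ.≤_)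
        (solve 2 (λ x y → con ⅛ :* ((con q5 :- x) :+ (con q5 :- y)) :+ con (ℤ.+ 1 ℚ./ 4)
                       := con ½ :- (:- (con 1ℚ :- con ⅛ :* (x :+ y)))) refl x y)
        (ℚ.+-mono-≤ {0ℚ} {_} {0ℚ}
          (0≤* {⅛} (ℚ.nonNegative⁻¹ ⅛) (ℚ.+-mono-≤ {0ℚ} {_} {0ℚ} (0≤b-a xh) (0≤b-a yh)))
          (ℚ.nonNegative⁻¹ (ℤ.+ 1 ℚ./ 4)))))

  ½^ : ℕ → ℚ
  ½^ zero    = 1ℚ
  ½^ (suc n) = ½ ℚ.* ½^ n

  ℕ→ℚ : ℕ → ℚ
  ℕ→ℚ zero    = 0ℚ
  ℕ→ℚ (suc n) = 1ℚ ℚ.+ ℕ→ℚ n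

  0≤½^ : ∀ n → 0ℚ ℚ.≤ ½^ n
  0≤½^ zero    = ℚ.nonNegative⁻¹ 1ℚ
  0≤½^ (suc n) = 0≤* {½} (ℚ.nonNegative⁻¹ ½) (0≤½^ n)

  ½^≤1 : ∀ n → ½^ n ℚ.≤ 1ℚ
  ½^≤1 zero    = ℚ.≤-refl
  ½^≤1 (suc n) = ℚ.≤-trans (ℚ.*-monoˡ-≤-nonNeg ½ (½^≤1 n)) (ℚ.≤ᵇ⇒≤ _)

  n½^n≤1 : ∀ n → ℕ→ℚ n ℚ.* ½^ n ℚ.≤ 1ℚ
  n½^n≤1 zero    = ℚ.≤-trans (ℚ.≤-reflexive (ℚ.*-zeroˡ 1ℚ)) (ℚ.nonNegative⁻¹ 1ℚ)
  n½^n≤1 (suc n) = subst (ℚ._≤ 1ℚ)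
    (solve 2 (λ k h → con ½ :* h :+ con ½ :* (k :* h) := (con 1ℚ :+ k) :* (con ½ :* h))
      refl (ℕ→ℚ n) (½^ n))
    (ℚ.+-mono-≤ {_} {½} {_} {½} (ℚ.*-monoˡ-≤-nonNeg ½ (½^≤1 n))
                              (ℚ.*-monoˡ-≤-nonNeg ½ (n½^n≤1 n)))

  ℕ→ℚ≡ : ∀ n → ℚ.toℚᵘ (ℕ→ℚ n) ℚᵘ.≃ ℚᵘ.mkℚᵘ (ℤ.+ n) 0
  ℕ→ℚ≡ zero    = ℚᵘ.≃-refl
  ℕ→ℚ≡ (suc n) = ℚᵘ.≃-trans (ℚ.toℚᵘ-homo-+ 1ℚ (ℕ→ℚ n))
    (ℚᵘ.≃-trans (ℚᵘ.+-congʳ ℚᵘ.1ℚᵘ (ℕ→ℚ≡ n))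
      (ℚᵘ.*≡* (cong (ℤ._* ℤ.+ 1) (cong (λ z → ℤ.+ 1 ℤ.+ z) (ℤ.*-identityʳ (ℤ.+ n))))))

  1≤denominator* : ∀ ε → 0ℚ ℚ.< ε → 1ℚ ℚ.≤ ℕ→ℚ (ℚ.denominatorℕ ε) ℚ.* ε
  1≤denominator* ε@(mkℚ (ℤ.+ suc p) d _) _ = ℚ.toℚᵘ-cancel-≤
    (ℚᵘ.≤-respʳ-≃
      (ℚᵘ.≃-sym (ℚᵘ.≃-trans (ℚ.toℚᵘ-homo-* (ℕ→ℚ (suc d)) ε)
                            (ℚᵘ.*-congʳ (ℕ→ℚ≡ (suc d)))))
      (ℚᵘ.*≤* (ℤ.+≤+ (ℕ.≤-trans
        (ℕ.≤-reflexive (trans (ℕ.*-identityˡ _) (ℕ.*-identityˡ _)))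
        (ℕ.≤-trans (ℕ.m≤m*n (suc d) (suc p)) (ℕ.≤-reflexive (sym (ℕ.*-identityʳ _))))))))
  1≤denominator* (mkℚ (ℤ.+ zero) d _) (ℚ.*<* (ℤ.+<+ ()))
  1≤denominator* (mkℚ (ℤ.-[1+ p ]) d _) (ℚ.*<* ())

  ½^-small : ∀ ε → 0ℚ ℚ.< ε → ∃[ N ] ½^ N ℚ.≤ ε
  ½^-small ε 0<ε = q , ℚ.*-cancelˡ-≤-pos (ℕ→ℚ q) {{ℚ.positive 0<q}}
                         (ℚ.≤-trans (n½^n≤1 q) (1≤denominator* ε 0<ε))
    where
    q : ℕ
    q = ℚ.denominatorℕ ε

    0≤ℕ→ℚ : ∀ n → 0ℚ ℚ.≤ ℕ→ℚ n
    0≤ℕ→ℚ zero    = ℚ.≤-refl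
    0≤ℕ→ℚ (suc n) = ℚ.+-mono-≤ {0ℚ} {_} {0ℚ} (ℚ.nonNegative⁻¹ 1ℚ) (0≤ℕ→ℚ n)

    0<q : 0ℚ ℚ.< ℕ→ℚ q
    0<q = ℚ.+-mono-<-≤ {0ℚ} {_} {0ℚ} (ℚ.positive⁻¹ 1ℚ) (0≤ℕ→ℚ (ℚ.denominator-1 ε))

  approx-close : ∀ N j k → ∣ approx (N ℕ.+ j) ℚ.- approx (N ℕ.+ k) ∣ ℚ.≤ ½^ N
  approx-close zero j k =
    let (jl , jh) = approx-In j
        (kl , kh) = approx-In k
    in ∣-∣-lub
         (ℚ.+-mono-≤ {_} {q5} {_} {ℚ.- q4} jh (ℚ.neg-antimono-≤ kl))
         (subst (ℚ._≤ 1ℚ)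
           (solve 2 (λ a b → b :- a := :- (a :- b)) refl (approx j) (approx k))
           (ℚ.+-mono-≤ {_} {q5} {_} {ℚ.- q4} kh (ℚ.neg-antimono-≤ jl)))
  approx-close (suc N) j k = ℚ.≤-trans
    (step-contracts (approx-In (N ℕ.+ j)) (approx-In (N ℕ.+ k)))
    (ℚ.*-monoˡ-≤-nonNeg ½ (approx-close N j k))

  approx-cauchy : IsCauchy approx
  approx-cauchy ε 0<ε =
    let (N , h) = ½^-small ε 0<ε
    in N , λ m n p q → ℚ.≤-trans
         (subst₂ (λ i j → ∣ approx i ℚ.- approx j ∣ ℚ.≤ ½^ N)
           (ℕ.m+[n∸m]≡n p) (ℕ.m+[n∸m]≡n q) (approx-close N (m ℕ.∸ N) (n ℕ.∸ N)))
         h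

√17 : ℝ
√17 = mkℝ approx approx-cauchy

√17-nonNeg : 0ℝ ≤ √17
√17-nonNeg ε 0<ε = 0 , λ n _ →
  ℚ.+-mono-≤ {0ℚ} {_} {0ℚ}
    (ℚ.≤-trans (ℚ.nonNegative⁻¹ q4) (proj₁ (approx-In n))) (ℚ.<⇒≤ 0<ε)

√17² : √17 * √17 ≈ fromℚ (ℤ.+ 17 ℚ./ 1)
√17² = (λ ε 0<ε → let (N , h) = near ε 0<ε in N , λ n p →
          a≤b (subst (0ℚ ℚ.≤_)
            (solve 2 (λ e s → e :- (:- (con q17 :- s)) := (con q17 :+ e) :- s) refl
              ε (approx n ℚ.* approx n))
            (0≤b-a (ℚ.≤-trans (-p≤∣p∣ (residual n)) (h n p)))))
     , (λ ε 0<ε → let (N , h) = near ε 0<ε in N , λ n p →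
          a≤b (subst (0ℚ ℚ.≤_)
            (solve 2 (λ e s → e :- (con q17 :- s) := (s :+ e) :- con q17) refl
              ε (approx n ℚ.* approx n))
            (0≤b-a (ℚ.≤-trans (p≤∣p∣ (residual n)) (h n p)))))
  where
  8ℚ : ℚ
  8ℚ = ℤ.+ 8 ℚ./ 1

  residual : ℕ → ℚ
  residual n = q17 ℚ.- approx n ℚ.* approx n

  -p≤∣p∣ : ∀ p → ℚ.- p ℚ.≤ ∣ p ∣
  -p≤∣p∣ p = subst (ℚ.- p ℚ.≤_) (ℚ.∣-p∣≡∣p∣ p) (p≤∣p∣ (ℚ.- p))

  residual≡ : ∀ n → residual n ≡ 8ℚ ℚ.* (approx (suc n) ℚ.- approx n)
  residual≡ n =
    solve 1 (λ x → con q17 :- x :* x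
                := con 8ℚ :* ((x :+ con ⅛ :* (con q17 :- x :* x)) :- x)) refl (approx n)

  near : ∀ ε → 0ℚ ℚ.< ε → ∃[ N ] (∀ n → N ℕ.≤ n → ∣ residual n ∣ ℚ.≤ ε)
  near ε 0<ε =
    let (δ , 0<δ , eq) = quotient 8ℚ ε (ℚ.positive⁻¹ 8ℚ) 0<ε
        (N , h)        = approx-cauchy δ 0<δ
    in N , λ n p → subst₂ ℚ._≤_
         (sym (trans (cong ∣_∣ (residual≡ n)) (ℚ.∣p*q∣≡∣p∣*∣q∣ 8ℚ (approx (suc n) ℚ.- approx n))))
         eq
         (ℚ.*-monoˡ-≤-nonNeg 8ℚ (h (suc n) n (ℕ.m≤n⇒m≤1+n p) p))

[5-√17]/2 : ℝ
[5-√17]/2 = fromℚ ½ * (fromℚ (ℤ.+ 5 ℚ./ 1) - √17)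

4/5 : ℝ
4/5 = fromℚ (ℤ.+ 4 ℚ./ 5)

------------------------------------------------------------------------
-- Weighted digraphs on the node set Fin m.  An absent arc (nothing) is
-- distinguished from an arc of weight 0, since arc existence can be queried.

Digraph : ℕ → Set
Digraph m = Fin m → Fin m → Maybe ℝ≥0

weight : Maybe ℝ≥0 → ℝ
weight (just (w , _)) = w
weight nothing        = 0ℝ

cut : ∀ {m} → Digraph m → Subset m → ℝ
cut {m} G S = sum (map (λ u → sum (map (crossing u) (allFin m))) (allFin m))
  where
  crossing : Fin m → Fin m → ℝ
  crossing u v = if does (u ∈? S) ∧ not (does (v ∈? S)) then weight (G u v) else 0ℝ

subsetsOf : ∀ {m} → Subset m → List (Subset m)
subsetsOf []            = [] ∷ []
subsetsOf (outside ∷ S) = map (outside ∷_) (subsetsOf S)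
subsetsOf (inside  ∷ S) = map (inside ∷_) (subsetsOf S) ++ map (outside ∷_) (subsetsOf S)

_≟ˢ_ : ∀ {m} → DecidableEquality (Subset m)
_≟ˢ_ = ≡-dec Bool._≟_

-- Sequences of revealed nodes are stored latest first: u_n ∷ … ∷ u_1 ∷ [].
record Instance : Set where
  field
    nodes    : ℕ
    graph    : Digraph nodes
    revealed : List (Fin nodes)
    distinct : Unique revealed

  groundSet : Subset nodes
  groundSet = foldr (λ u S → ⁅ u ⁆ ∪ S) ⊥ revealed

  -- The starting value 0ℝ is the value of the (feasible) empty set.
  opt : ℝ
  opt = foldr _⊔_ 0ℝ (map (cut graph) (subsetsOf groundSet))

------------------------------------------------------------------------
-- Online algorithms

data Access : Set where
  arcsLeavingRevealed allArcs : Access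

Information : Access → ∀ {m} → List (Fin m) → Set
Information arcsLeavingRevealed {m} us = ∀ {u} → u ∈ us → Fin m → Maybe ℝ≥0
Information allArcs             {m} us = Digraph m

inform : ∀ a {m} → Digraph m → (us : List (Fin m)) → Information a us
inform arcsLeavingRevealed G us {u} _ = G u
inform allArcs             G us       = G

-- The solution chosen right after the head of us is revealed.  It depends on
-- the node set, the revealed sequence and the accessible arcs only; these
-- determine the earlier solutions of a deterministic algorithm as well.
record DeterministicAlgorithm (a : Access) : Set where
  field
    choose : ∀ {m} (us : List (Fin m)) → Information a us → Subset m

  solution : ∀ {m} → Digraph m → List (Fin m) → Subset m
  solution G us = choose us (inform a G us)

  field
    initial : ∀ {m} (G : Digraph m) → solution G [] ≡ ⊥
    update  : ∀ {m} (G : Digraph m) u us → Unique (u ∷ us) →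
              solution G (u ∷ us) ⊆ solution G us ∪ ⁅ u ⁆

open DeterministicAlgorithm public using (solution)

-- Only random variables with finitely many values are integrated below, so
-- finite additivity is enough; every probability space gives one of these.
-- The values of P outside Measurable are irrelevant.
record ProbabilitySpace : Set₁ where
  field
    Ω          : Set
    Measurable : (Ω → Bool) → Set
    P          : (Ω → Bool) → ℝ

    measurable-cong : ∀ {A B} → (∀ ω → A ω ≡ B ω) → Measurable A → Measurable B
    measurable-Ω    : Measurable (λ _ → true)
    measurable-∁    : ∀ {A} → Measurable A → Measurable (λ ω → not (A ω))
    measurable-∪    : ∀ {A B} → Measurable A → Measurable B → Measurable (λ ω → A ω ∨ B ω)

    P-cong   : ∀ {A B} → Measurable A → Measurable B → (∀ ω → A ω ≡ B ω) → P A ≈ P B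
    P-nonNeg : ∀ {A} → Measurable A → 0ℝ ≤ P A
    P-Ω      : P (λ _ → true) ≈ 1ℝ
    P-∪      : ∀ {A B} → Measurable A → Measurable B → (∀ ω → A ω ∧ B ω ≡ false) →
               P (λ ω → A ω ∨ B ω) ≈ P A + P B

-- A randomized algorithm is a random deterministic algorithm; ω is the outcome
-- of all its internal randomness, and so is independent of the instance.
record RandomizedAlgorithm (a : Access) : Set₁ where
  field
    space : ProbabilitySpace

  open ProbabilitySpace space

  field
    run : Ω → DeterministicAlgorithm a

  outputs : ∀ {m} → Digraph m → List (Fin m) → Subset m → Ω → Bool
  outputs G us S ω = does (solution (run ω) G us ≟ˢ S)

  field
    run-measurable : ∀ {m} (G : Digraph m) us → Unique us → ∀ S → Measurable (outputs G us S)

  expectedValue : ∀ {m} → Digraph m → List (Fin m) → ℝ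
  expectedValue G us = sum (map (λ S → P (outputs G us S) * cut G S) (subsetsOf ⊤))

CompetitiveDeterministic : ∀ {a} → ℝ → DeterministicAlgorithm a → Set
CompetitiveDeterministic α A =
  ∀ (I : Instance) → let open Instance I in
  α * opt ≤ cut graph (solution A graph revealed)

CompetitiveRandomized : ∀ {a} → ℝ → RandomizedAlgorithm a → Set
CompetitiveRandomized α A =
  ∀ (I : Instance) → let open Instance I in
  α * opt ≤ RandomizedAlgorithm.expectedValue A graph revealed

{-# OPTIONS --safe #-}

-- Both bounds come from one graph in which the nodes 0 and 1 compete (0 → 1 and
-- 1 → 0), the nodes 2 and 4 devalue 0 (2 → 0, 4 → 0) and the nodes 3 and 5
-- devalue 1 (3 → 1, 5 → 1), all with weight 1; the light arcs 0 → 2 and 1 → 3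
-- have weight c.  After 0 and 1, the input may stop, or continue with devaluers
-- of whichever node was kept.
--
-- For randomized algorithms, c = 0 and the inputs 01, 012, 013 have optimal values
-- 1, 2, 2, while the values obtained always add up to at most 4.
--
-- For deterministic algorithms, c = (√17 - 3) / 4.  Keeping both 0 and 1 gives
-- 2c / (1 + c).  Keeping only 0, the algorithm faces 2: it ends with value at
-- most 1 against 2 + c, unless it drops 2, and then 4 leaves it with 1 + c against
-- 3 + c.  This c makes the first two ratios equal, namely (5 - √17) / 2.

module Submission where

open import Defs
open import Data.Bool.Base using (Bool; true; false; _∧_; _∨_; not; if_then_else_)
import Data.Bool.Properties as Bool
open import Data.Empty using () renaming (⊥ to ⊥₀)
open import Data.Fin.Base using (Fin)
open import Data.Fin.Patterns using (0F; 1F; 2F; 3F; 4F; 5F)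
import Data.Fin.Properties as Fin
open import Data.Fin.Subset using (Subset; inside; outside; ⊥; ⊤; ⁅_⁆; _∪_; _⊆_)
  renaming (_∈_ to _∈ˢ_)
open import Data.Fin.Subset.Properties
  using (_∈?_; _⊆?_; drop-∷-⊆; x∈p∪q⁺; x∈p∪q⁻)
import Data.Integer.Base as ℤ
open import Data.List.Base using (List; []; _∷_; _++_; map; foldr; allFin)
open import Data.List.Membership.Propositional using (_∈_)
open import Data.List.Membership.Propositional.Properties using (∈-map⁺; ∈-++⁺ˡ; ∈-++⁺ʳ)
open import Data.List.Properties using (map-∘; map-++)
open import Data.List.Relation.Unary.All as All using (All; []; _∷_)
open import Data.List.Relation.Unary.All.Properties as All using ()
open import Data.List.Relation.Unary.AllPairs as AllPairs using ()
open import Data.List.Relation.Unary.Any using (here; there)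
open import Data.List.Relation.Unary.Unique.Propositional using (Unique)
open import Data.List.Relation.Unary.Unique.DecPropositional (Fin._≟_ {6}) using (unique?)
open import Data.Maybe.Base using (Maybe; just; nothing)
open import Data.Nat.Base as ℕ using (ℕ; zero; suc)
import Data.Nat.Properties as ℕ
open import Data.Product.Base using (∃-syntax; _×_; _,_; proj₁; proj₂)
open import Data.Rational.Base as ℚ using (ℚ; 0ℚ; 1ℚ; ½)
import Data.Rational.Properties as ℚ
open import Data.Rational.Solver using (module +-*-Solver)
open import Data.Sum.Base as Sum using (inj₁; inj₂)
open import Data.Vec.Base using ([]; _∷_; here; there)
open import Relation.Binary.Bundles using (Preorder)
open import Relation.Binary.PropositionalEquality
open import Relation.Nullary.Decidable
  using (Dec; does; yes; no; from-yes; True; toWitness)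
open import Relation.Nullary.Negation.Core using (¬_; contradiction)

open +-*-Solver using (solve; _:=_; _:+_; _:*_; :-_; _:-_; con)

-- Rational constants, finite sums and inequalities.

q2 q3 q4 q5 q17 q4/5 ¼ ⅛ : ℚ
q2   = ℤ.+ 2 ℚ./ 1
q3   = ℤ.+ 3 ℚ./ 1
q4   = ℤ.+ 4 ℚ./ 1
q5   = ℤ.+ 5 ℚ./ 1
q17  = ℤ.+ 17 ℚ./ 1
q4/5 = ℤ.+ 4 ℚ./ 5
¼    = ℤ.+ 1 ℚ./ 4
⅛    = ℤ.+ 1 ℚ./ 8

Σℚ : List ℚ → ℚ
Σℚ = foldr ℚ._+_ 0ℚ

Σℚ-++ : ∀ xs ys → Σℚ (xs ++ ys) ≡ Σℚ xs ℚ.+ Σℚ ys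
Σℚ-++ []       ys = sym (ℚ.+-identityˡ (Σℚ ys))
Σℚ-++ (x ∷ xs) ys = trans (cong (x ℚ.+_) (Σℚ-++ xs ys)) (sym (ℚ.+-assoc x (Σℚ xs) (Σℚ ys)))

Σℚ-zero : ∀ {X : Set} (xs : List X) → Σℚ (map (λ _ → 0ℚ) xs) ≡ 0ℚ
Σℚ-zero []       = refl
Σℚ-zero (x ∷ xs) = trans (ℚ.+-identityˡ _) (Σℚ-zero xs)

-- Induction on the number of nodes: the half of the list that disagrees with `S` on the first node
-- contributes only zeros, and the other half is the induction hypothesis. This evaluates a simple
-- function built from the outputs of a random algorithm.
Σℚ-indicator : ∀ {m} (g : Subset m → ℚ) S →
  Σℚ (map (λ T → if does (S ≟ˢ T) then g T else 0ℚ) (subsetsOf ⊤)) ≡ g S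
Σℚ-indicator g [] = ℚ.+-identityʳ (g [])
Σℚ-indicator {suc m} g (b ∷ S) = begin
  Σℚ (map f (map (inside ∷_) X ++ map (outside ∷_) X))
    ≡⟨ cong Σℚ (map-++ f (map (inside ∷_) X) _) ⟩
  Σℚ (map f (map (inside ∷_) X) ++ map f (map (outside ∷_) X))
    ≡⟨ Σℚ-++ (map f (map (inside ∷_) X)) _ ⟩
  Σℚ (map f (map (inside ∷_) X)) ℚ.+ Σℚ (map f (map (outside ∷_) X))
    ≡⟨ cong₂ (λ xs ys → Σℚ xs ℚ.+ Σℚ ys) (sym (map-∘ X)) (sym (map-∘ X)) ⟩
  Σℚ (map (λ T → f (inside ∷ T)) X) ℚ.+ Σℚ (map (λ T → f (outside ∷ T)) X)
    ≡⟨ split b ⟩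
  g (b ∷ S) ∎
  where
  open ≡-Reasoning
  X : List (Subset m)
  X = subsetsOf ⊤

  f : Subset (suc m) → ℚ
  f T = if does ((b ∷ S) ≟ˢ T) then g T else 0ℚ

  split : ∀ b → let f = λ T → if does ((b ∷ S) ≟ˢ T) then g T else 0ℚ in
    Σℚ (map (λ T → f (inside ∷ T)) X) ℚ.+ Σℚ (map (λ T → f (outside ∷ T)) X) ≡ g (b ∷ S)
  split true  = trans (cong₂ ℚ._+_ (Σℚ-indicator (λ T → g (true ∷ T)) S) (Σℚ-zero X))
                      (ℚ.+-identityʳ _)
  split false = trans (cong₂ ℚ._+_ (Σℚ-zero X) (Σℚ-indicator (λ T → g (false ∷ T)) S))
                      (ℚ.+-identityˡ _)

0≤b-a : ∀ {a b} → a ℚ.≤ b → 0ℚ ℚ.≤ b ℚ.- a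
0≤b-a {a} {b} h = subst (ℚ._≤ b ℚ.- a) (ℚ.+-inverseʳ a) (ℚ.+-monoˡ-≤ (ℚ.- a) h)

0≤b-a⇒a≤b : ∀ {a b} → 0ℚ ℚ.≤ b ℚ.- a → a ℚ.≤ b
0≤b-a⇒a≤b {a} {b} h = subst₂ ℚ._≤_ (ℚ.+-identityʳ a)
  (solve 2 (λ x y → x :+ (y :- x) := y) refl a b) (ℚ.+-monoʳ-≤ a h)

0≤+ : ∀ {a b} → 0ℚ ℚ.≤ a → 0ℚ ℚ.≤ b → 0ℚ ℚ.≤ a ℚ.+ b
0≤+ = ℚ.+-mono-≤ {0ℚ} {_} {0ℚ}

0≤* : ∀ {a b} → 0ℚ ℚ.≤ a → 0ℚ ℚ.≤ b → 0ℚ ℚ.≤ a ℚ.* b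
0≤* {a} {b} ha hb =
  subst (ℚ._≤ a ℚ.* b) (ℚ.*-zeroʳ a) (ℚ.*-monoˡ-≤-nonNeg a {{ℚ.nonNegative ha}} hb)

a≤a+b : ∀ {a b} → 0ℚ ℚ.≤ b → a ℚ.≤ a ℚ.+ b
a≤a+b {a} {b} h = subst (ℚ._≤ a ℚ.+ b) (ℚ.+-identityʳ a) (ℚ.+-monoʳ-≤ a h)

0<½* : ∀ {ε} → 0ℚ ℚ.< ε → 0ℚ ℚ.< ½ ℚ.* ε
0<½* {ε} h = subst (ℚ._< ½ ℚ.* ε) (ℚ.*-zeroʳ ½) (ℚ.*-monoʳ-<-pos ½ h)

-- Dividing `ε` by `q + 1` instead of `q` avoids a separate case for `q = 0`.
absorb : ∀ q ε → 0ℚ ℚ.≤ q → 0ℚ ℚ.< ε → ∃[ δ ] (0ℚ ℚ.< δ × q ℚ.* δ ℚ.≤ ε)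
absorb q ε 0≤q 0<ε = δ , 0<δ , subst (q ℚ.* δ ℚ.≤_) pδ≡ε
    (ℚ.*-monoʳ-≤-nonNeg δ {{ℚ.nonNegative (ℚ.<⇒≤ 0<δ)}} (a≤a+b {q} (ℚ.nonNegative⁻¹ 1ℚ)))
  where
  p : ℚ
  p = q ℚ.+ 1ℚ

  0<p : 0ℚ ℚ.< p
  0<p = ℚ.+-mono-≤-< 0≤q (ℚ.positive⁻¹ 1ℚ)

  p-nz : ℚ.NonZero p
  p-nz = ℚ.pos⇒nonZero p {{ℚ.positive 0<p}}

  δ : ℚ
  δ = (ℚ.1/_ p {{p-nz}}) ℚ.* ε

  pδ≡ε : p ℚ.* δ ≡ ε
  pδ≡ε = trans (sym (ℚ.*-assoc p (ℚ.1/_ p {{p-nz}}) ε))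
           (trans (cong (ℚ._* ε) (ℚ.*-inverseʳ p {{p-nz}})) (ℚ.*-identityˡ ε))

  0<δ : 0ℚ ℚ.< δ
  0<δ = ℚ.*-cancelˡ-<-nonNeg p {{ℚ.nonNegative (ℚ.<⇒≤ 0<p)}}
          (subst₂ ℚ._<_ (sym (ℚ.*-zeroʳ p)) (sym pδ≡ε) 0<ε)

-- The ordered additive group of the reals

-- The operations on reals act on the sequences termwise, so this and `pointwise-≈` reduce algebra
-- with reals to the ring solver for rationals.
pointwise-≤ : ∀ {x y} → (∀ n → seq x n ℚ.≤ seq y n) → x ≤ y
pointwise-≤ h ε 0<ε = 0 , λ n _ → ℚ.≤-trans (h n) (a≤a+b (ℚ.<⇒≤ 0<ε))

pointwise-≈ : ∀ {x y} → (∀ n → seq x n ≡ seq y n) → x ≈ y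
pointwise-≈ {x} {y} h = pointwise-≤ {x} {y} (λ n → ℚ.≤-reflexive (h n))
                      , pointwise-≤ {y} {x} (λ n → ℚ.≤-reflexive (sym (h n)))

≤-refl : ∀ {x} → x ≤ x
≤-refl {x} = pointwise-≤ {x} {x} λ _ → ℚ.≤-refl

+-halves : ∀ {p q r} ε → p ℚ.≤ q ℚ.+ ½ ℚ.* ε → q ℚ.≤ r ℚ.+ ½ ℚ.* ε → p ℚ.≤ r ℚ.+ ε
+-halves {p} {q} {r} ε h k = ℚ.≤-trans h (subst (q ℚ.+ ½ ℚ.* ε ℚ.≤_)
  (solve 2 (λ r e → (r :+ con ½ :* e) :+ con ½ :* e := r :+ e) refl r ε)
  (ℚ.+-monoˡ-≤ (½ ℚ.* ε) k))

≤-trans : ∀ {x y z} → x ≤ y → y ≤ z → x ≤ z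
≤-trans {z = z} h k ε 0<ε =
  let (M , h′) = h (½ ℚ.* ε) (0<½* 0<ε)
      (N , k′) = k (½ ℚ.* ε) (0<½* 0<ε)
  in M ℕ.⊔ N , λ n p →
       +-halves {r = seq z n} ε (h′ n (ℕ.m⊔n≤o⇒m≤o M N p)) (k′ n (ℕ.m⊔n≤o⇒n≤o M N p))

+-mono-≤ : ∀ {x y u v} → x ≤ y → u ≤ v → x + u ≤ y + v
+-mono-≤ {x} {y} {u} {v} h k ε 0<ε =
  let (M , h′) = h (½ ℚ.* ε) (0<½* 0<ε)
      (N , k′) = k (½ ℚ.* ε) (0<½* 0<ε)
  in M ℕ.⊔ N , λ n p → subst (seq x n ℚ.+ seq u n ℚ.≤_)
       (solve 3 (λ y v e → (y :+ con ½ :* e) :+ (v :+ con ½ :* e) := (y :+ v) :+ e)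
         refl (seq y n) (seq v n) ε)
       (ℚ.+-mono-≤ (h′ n (ℕ.m⊔n≤o⇒m≤o M N p)) (k′ n (ℕ.m⊔n≤o⇒n≤o M N p)))

scale-mono-≤ : ∀ {q x y} → 0ℚ ℚ.≤ q → x ≤ y → fromℚ q * x ≤ fromℚ q * y
scale-mono-≤ {q} {x} {y} 0≤q h ε 0<ε =
  let (δ , 0<δ , qδ≤ε) = absorb q ε 0≤q 0<ε
      (N , h′) = h δ 0<δ
  in N , λ n p → ℚ.≤-trans
       (ℚ.*-monoˡ-≤-nonNeg q {{ℚ.nonNegative 0≤q}} (h′ n p))
       (subst (ℚ._≤ q ℚ.* seq y n ℚ.+ ε) (sym (ℚ.*-distribˡ-+ q (seq y n) δ))
         (ℚ.+-monoʳ-≤ (q ℚ.* seq y n) qδ≤ε))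

scale-antimono-≤ : ∀ {q x y} → q ℚ.≤ 0ℚ → x ≤ y → fromℚ q * y ≤ fromℚ q * x
scale-antimono-≤ {q} {x} {y} q≤0 h ε 0<ε =
  let (N , h′) = scale-mono-≤ {ℚ.- q} {x} {y} (ℚ.neg-antimono-≤ q≤0) h ε 0<ε
  in N , λ n p → 0≤b-a⇒a≤b (subst (0ℚ ℚ.≤_)
       (solve 4 (λ q x y e → ((:- q) :* y :+ e) :- (:- q) :* x := (q :* x :+ e) :- q :* y)
         refl q (seq x n) (seq y n) ε)
       (0≤b-a (h′ n p)))

-- The multiplier is rational, so its sign can be decided. Negative multipliers do arise: `∫-≤`
-- replaces a bound `k` by `k - c`.
scale-cong : ∀ q {x y} → x ≈ y → fromℚ q * x ≈ fromℚ q * y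
scale-cong q {x} {y} (h , k) with ℚ.≤-total 0ℚ q
... | inj₁ 0≤q = scale-mono-≤ {q} {x} {y} 0≤q h , scale-mono-≤ {q} {y} {x} 0≤q k
... | inj₂ q≤0 = scale-antimono-≤ {q} {y} {x} q≤0 k , scale-antimono-≤ {q} {x} {y} q≤0 h

≤-preorder : Preorder _ _ _
≤-preorder = record
  { Carrier = ℝ ; _≈_ = _≈_ ; _≲_ = _≤_
  ; isPreorder = record
    { isEquivalence = record
      { refl  = λ {x} → ≤-refl {x} , ≤-refl {x}
      ; sym   = λ (h , k) → k , h
      ; trans = λ {x} {y} {z} (h , k) (h′ , k′) →
          ≤-trans {x} {y} {z} h h′ , ≤-trans {z} {y} {x} k′ k }
    ; reflexive = proj₁
    ; trans     = λ {x} {y} {z} → ≤-trans {x} {y} {z} } }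

open import Relation.Binary.Reasoning.Preorder ≤-preorder as ≤-Reasoning

seq-sum-++ : ∀ n xs ys → seq (sum (xs ++ ys)) n ≡ seq (sum xs) n ℚ.+ seq (sum ys) n
seq-sum-++ n []       ys = sym (ℚ.+-identityˡ _)
seq-sum-++ n (x ∷ xs) ys =
  trans (cong (seq x n ℚ.+_) (seq-sum-++ n xs ys)) (sym (ℚ.+-assoc (seq x n) _ _))

sum-map-mono-≤ : ∀ {X : Set} (f g : X → ℝ) xs → (∀ x → f x ≤ g x) →
                 sum (map f xs) ≤ sum (map g xs)
sum-map-mono-≤ f g []       h = ≤-refl {0ℝ}
sum-map-mono-≤ f g (x ∷ xs) h =
  +-mono-≤ {f x} {g x} {sum (map f xs)} {sum (map g xs)} (h x) (sum-map-mono-≤ f g xs h)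

-- Simple functions, as finite sums of multiples of indicators

module Expectation (space : ProbabilitySpace) where
  open ProbabilitySpace space

  Event : Set
  Event = Ω → Bool

  infixr 7 _∩_
  _∩_ : Event → Event → Event
  (A ∩ B) ω = A ω ∧ B ω

  ∁ : Event → Event
  ∁ A ω = not (A ω)

  everything nothingness : Event
  everything  _ = true
  nothingness _ = false

  measurable-∩ : ∀ {A B} → Measurable A → Measurable B → Measurable (A ∩ B)
  measurable-∩ {A} {B} hA hB = measurable-cong
    (λ ω → deMorgan (A ω) (B ω))
    (measurable-∁ (measurable-∪ (measurable-∁ hA) (measurable-∁ hB)))
    where
    deMorgan : ∀ a b → not (not a ∨ not b) ≡ a ∧ b
    deMorgan false _     = refl
    deMorgan true  false = refl
    deMorgan true  true  = refl

  measurable-∅ : Measurable nothingness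
  measurable-∅ = measurable-∁ measurable-Ω

  -- The empty event is the disjoint union of two copies of itself, so its probability `x` satisfies
  -- `x + x ≤ x`.
  P-∅ : P nothingness ≤ 0ℝ
  P-∅ ε 0<ε =
    let (N , h) = proj₂ (P-∪ measurable-∅ measurable-∅ (λ _ → refl)) ε 0<ε
    in N , λ n p → 0≤b-a⇒a≤b (subst (0ℚ ℚ.≤_)
         (solve 2 (λ x e → (x :+ e) :- (x :+ x) := (con 0ℚ :+ e) :- x) refl
           (seq (P nothingness) n) ε)
         (0≤b-a (h n p)))

  -- `D` is the event of one term of an integral over `B`. Bracketed to the right, the two pieces
  -- are the matching terms of the integrals over `A ∩ B` and `∁ A ∩ B`.
  P-split : ∀ {A B D} → Measurable A → Measurable B → Measurable D →
            P (D ∩ A ∩ B) + P (D ∩ ∁ A ∩ B) ≈ P (D ∩ B)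
  P-split {A} {B} {D} hA hB hD = additivity
    where
    l r : Event
    l = D ∩ A ∩ B
    r = D ∩ ∁ A ∩ B

    hl : Measurable l
    hl = measurable-∩ hD (measurable-∩ hA hB)

    hr : Measurable r
    hr = measurable-∩ hD (measurable-∩ (measurable-∁ hA) hB)

    disjoint : ∀ d a b → (d ∧ a ∧ b) ∧ (d ∧ not a ∧ b) ≡ false
    disjoint false _     _     = refl
    disjoint true  false _     = refl
    disjoint true  true  false = refl
    disjoint true  true  true  = refl

    cover : ∀ d a b → (d ∧ a ∧ b) ∨ (d ∧ not a ∧ b) ≡ d ∧ b
    cover false _     _     = refl
    cover true  false _     = refl
    cover true  true  false = refl
    cover true  true  true  = refl

    union : P (λ ω → l ω ∨ r ω) ≈ P l + P r
    union = P-∪ hl hr (λ ω → disjoint (D ω) (A ω) (B ω))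

    same : P (λ ω → l ω ∨ r ω) ≈ P (D ∩ B)
    same = P-cong (measurable-∪ hl hr) (measurable-∩ hD hB) (λ ω → cover (D ω) (A ω) (B ω))

    additivity : P l + P r ≈ P (D ∩ B)
    additivity = ≤-trans {P l + P r} {P (λ ω → l ω ∨ r ω)} {P (D ∩ B)} (proj₂ union) (proj₁ same)
               , ≤-trans {P (D ∩ B)} {P (λ ω → l ω ∨ r ω)} {P l + P r} (proj₂ same) (proj₁ union)

  Simple : Set
  Simple = List (Event × ℚ)

  termValue : Ω → Event × ℚ → ℚ
  termValue ω (A , c) = if A ω then c else 0ℚ

  value : Simple → Ω → ℚ
  value L ω = Σℚ (map (termValue ω) L)

  -- Opaque, since comparing products of reals for definitional equality unfolds
  -- their convergence proofs.
  opaque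
    ∫term : Event → Event × ℚ → ℝ
    ∫term B (A , c) = fromℚ c * P (A ∩ B)

    scale-P-≤-∫term : ∀ {A} c → Measurable A → fromℚ c * P A ≤ ∫term everything (A , c)
    scale-P-≤-∫term {A} c hA = proj₁ (scale-cong c {P A} {P (A ∩ everything)}
      (P-cong hA (measurable-∩ hA measurable-Ω) (λ ω → sym (Bool.∧-identityʳ (A ω)))))

  ∫ : Event → Simple → ℝ
  ∫ B L = sum (map (∫term B) L)

  AllMeasurable : Simple → Set
  AllMeasurable = All (λ (A , _) → Measurable A)

  opaque
    unfolding ∫term

    ∫-split : ∀ {A B} L → Measurable A → Measurable B → AllMeasurable L →
              ∫ B L ≤ ∫ (A ∩ B) L + ∫ (∁ A ∩ B) L
    ∫-split         []            hA hB _         = pointwise-≤ {0ℝ} {0ℝ + 0ℝ} λ _ → ℚ.≤-refl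
    ∫-split {A} {B} ((D , c) ∷ L) hA hB (hD ∷ hL) = begin
      fromℚ c * P (D ∩ B) + ∫ B L
        ≲⟨ +-mono-≤ {fromℚ c * P (D ∩ B)} {fromℚ c * (x + y)} {∫ B L} {X + Y}
             (proj₂ (scale-cong c {x + y} {P (D ∩ B)} (P-split {A} {B} {D} hA hB hD))) (∫-split {A} {B} L hA hB hL) ⟩
      fromℚ c * (x + y) + (X + Y)
        ≈⟨ pointwise-≈ {fromℚ c * (x + y) + (X + Y)} {(fromℚ c * x + X) + (fromℚ c * y + Y)}
             (λ n → solve 5 (λ c x y X Y → c :* (x :+ y) :+ (X :+ Y) := (c :* x :+ X) :+ (c :* y :+ Y))
                     refl c (seq x n) (seq y n) (seq X n) (seq Y n)) ⟩
      (fromℚ c * x + X) + (fromℚ c * y + Y) ∎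
      where
      open ≤-Reasoning
      x y X Y : ℝ
      x = P (D ∩ A ∩ B)
      y = P (D ∩ ∁ A ∩ B)
      X = ∫ (A ∩ B) L
      Y = ∫ (∁ A ∩ B) L

  -- Base case of `∫-≤`, where the simple function is zero. If `k` is negative, the hypothesis makes
  -- `B` empty, and a negative multiple of a probability that is at most zero is nonnegative.
  0≤scale-P : ∀ {B} k → Measurable B → Dec (0ℚ ℚ.≤ k) → (∀ ω → B ω ≡ true → 0ℚ ℚ.≤ k) →
              0ℝ ≤ fromℚ k * P B
  0≤scale-P {B} k hB (yes 0≤k) h = begin
    0ℝ              ≈⟨ pointwise-≈ {0ℝ} {fromℚ k * 0ℝ} (λ _ → sym (ℚ.*-zeroʳ k)) ⟩
    fromℚ k * 0ℝ    ≲⟨ scale-mono-≤ {k} {0ℝ} {P B} 0≤k (P-nonNeg hB) ⟩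
    fromℚ k * P B   ∎
    where open ≤-Reasoning
  0≤scale-P {B} k hB (no k<0) h = begin
    0ℝ              ≈⟨ pointwise-≈ {0ℝ} {fromℚ k * 0ℝ} (λ _ → sym (ℚ.*-zeroʳ k)) ⟩
    fromℚ k * 0ℝ    ≲⟨ scale-antimono-≤ {k} {P B} {0ℝ} (ℚ.<⇒≤ (ℚ.≰⇒> k<0)) PB≤0 ⟩
    fromℚ k * P B   ∎
    where
    open ≤-Reasoning
    PB≤0 : P B ≤ 0ℝ
    PB≤0 = ≤-trans {P B} {P nothingness} {0ℝ}
      (proj₁ (P-cong hB measurable-∅ (λ ω → Bool.¬-not (λ e → k<0 (h ω e))))) P-∅

  opaque
    unfolding ∫term

    -- Splitting B along the first event makes its coefficient a constant, which
    -- is then moved into the bound.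
    ∫-≤ : ∀ {B} L k → Measurable B → AllMeasurable L →
          (∀ ω → B ω ≡ true → value L ω ℚ.≤ k) → ∫ B L ≤ fromℚ k * P B
    ∫-≤ [] k hB _ h = 0≤scale-P k hB (0ℚ ℚ.≤? k) h
    ∫-≤ {B} ((A , c) ∷ L) k hB (hA ∷ hL) h = begin
      fromℚ c * x + ∫ B L
        ≲⟨ +-mono-≤ {fromℚ c * x} {fromℚ c * x} {∫ B L} {∫ (A ∩ B) L + ∫ (∁ A ∩ B) L}
             (≤-refl {fromℚ c * x}) (∫-split {A} {B} L hA hB hL) ⟩
      fromℚ c * x + (∫ (A ∩ B) L + ∫ (∁ A ∩ B) L)
        ≲⟨ +-mono-≤ {fromℚ c * x} {fromℚ c * x} {∫ (A ∩ B) L + ∫ (∁ A ∩ B) L} {X + Y}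
             (≤-refl {fromℚ c * x})
             (+-mono-≤ {∫ (A ∩ B) L} {X} {∫ (∁ A ∩ B) L} {Y}
               (∫-≤ {A ∩ B} L (k ℚ.- c) (measurable-∩ hA hB) hL
                 (λ ω e → let (a , b) = ∧-true {A ω} e in on {A ω} {value L ω} (h ω b) a))
               (∫-≤ {∁ A ∩ B} L k (measurable-∩ (measurable-∁ hA) hB) hL
                 (λ ω e → let (a , b) = ∧-true {not (A ω)} e in off {A ω} {value L ω} (h ω b) a))) ⟩
      fromℚ c * x + (X + Y)
        ≈⟨ pointwise-≈ {fromℚ c * x + (X + Y)} {fromℚ k * (x + y)}
             (λ n → solve 4 (λ c k x y → c :* x :+ ((k :- c) :* x :+ k :* y) := k :* (x :+ y))
                     refl c k (seq x n) (seq y n)) ⟩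
      fromℚ k * (x + y)
        -- `everything ∩ X` computes to `X`, so `D = everything` turns `P-split` into additivity for
        -- `B` itself.
        ≲⟨ proj₁ (scale-cong k {x + y} {P B} (P-split {A} {B} {everything} hA hB measurable-Ω)) ⟩
      fromℚ k * P B ∎
      where
      open ≤-Reasoning
      x y X Y : ℝ
      x = P (A ∩ B)
      y = P (∁ A ∩ B)
      X = fromℚ (k ℚ.- c) * x
      Y = fromℚ k * y

      on : ∀ {b v} → (if b then c else 0ℚ) ℚ.+ v ℚ.≤ k → b ≡ true → v ℚ.≤ k ℚ.- c
      on {v = v} h refl = 0≤b-a⇒a≤b (subst (0ℚ ℚ.≤_)
        (solve 3 (λ k c v → k :- (c :+ v) := (k :- c) :- v) refl k c v) (0≤b-a h))

      off : ∀ {b v} → (if b then c else 0ℚ) ℚ.+ v ℚ.≤ k → not b ≡ true → v ℚ.≤ k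
      off {false} {v} h _ = subst (ℚ._≤ k) (ℚ.+-identityˡ v) h

      ∧-true : ∀ {a b} → a ∧ b ≡ true → a ≡ true × b ≡ true
      ∧-true {true} e = refl , e

  seq-∫-++ : ∀ B n L M → seq (∫ B (L ++ M)) n ≡ seq (∫ B L) n ℚ.+ seq (∫ B M) n
  seq-∫-++ B n L M = trans (cong (λ xs → seq (sum xs) n) (map-++ (∫term B) L M))
    (seq-sum-++ n (map (∫term B) L) (map (∫term B) M))

  value-++ : ∀ L M ω → value (L ++ M) ω ≡ value L ω ℚ.+ value M ω
  value-++ L M ω = trans (cong Σℚ (map-++ (termValue ω) L M))
    (Σℚ-++ (map (termValue ω) L) (map (termValue ω) M))

-- Cut values of rational weights, and of affine combinations of them

crosses : ∀ {m} → Subset m → Fin m → Fin m → Bool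
crosses S u v = does (u ∈? S) ∧ not (does (v ∈? S))

cutℚ : ∀ {m} → (Fin m → Fin m → ℚ) → Subset m → ℚ
cutℚ {m} w S = Σℚ (map (λ u → Σℚ (map (crossing u) (allFin m))) (allFin m))
  where
  crossing : Fin m → Fin m → ℚ
  crossing u v = if crosses S u v then w u v else 0ℚ

0≡0+0* : ∀ c → 0ℚ ≡ 0ℚ ℚ.+ 0ℚ ℚ.* c
0≡0+0* c = sym (trans (ℚ.+-identityˡ _) (ℚ.*-zeroˡ c))

seq-sum-affine : ∀ {X : Set} (f : X → ℝ) (g h : X → ℚ) n c →
  (∀ x → seq (f x) n ≡ g x ℚ.+ h x ℚ.* c) →
  ∀ xs → seq (sum (map f xs)) n ≡ Σℚ (map g xs) ℚ.+ Σℚ (map h xs) ℚ.* c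
seq-sum-affine f g h n c eq []       = 0≡0+0* c
seq-sum-affine f g h n c eq (x ∷ xs) =
  trans (cong₂ ℚ._+_ (eq x) (seq-sum-affine f g h n c eq xs))
    (solve 5 (λ g h G H c → (g :+ h :* c) :+ (G :+ H :* c) := (g :+ G) :+ (h :+ H) :* c)
      refl (g x) (h x) (Σℚ (map g xs)) (Σℚ (map h xs)) c)

-- For a concrete set and a concrete shape of graph, both coefficients are closed rationals, so they
-- can be compared by evaluation although the weight `c` is real.
seq-cut-affine : ∀ {m} (G : Digraph m) (A B : Fin m → Fin m → ℚ) n c →
  (∀ u v → seq (weight (G u v)) n ≡ A u v ℚ.+ B u v ℚ.* c) →
  ∀ S → seq (cut G S) n ≡ cutℚ A S ℚ.+ cutℚ B S ℚ.* c
seq-cut-affine {m} G A B n c eq S =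
  seq-sum-affine (λ u → sum (map (real u) (allFin m)))
    (λ u → Σℚ (map (rational A u) (allFin m))) (λ u → Σℚ (map (rational B u) (allFin m))) n c
    (λ u → seq-sum-affine (real u) (rational A u) (rational B u) n c
      (λ v → if-affine (crosses S u v) {weight (G u v)} (eq u v)) (allFin m)) (allFin m)
  where
  real : Fin m → Fin m → ℝ
  real u v = if crosses S u v then weight (G u v) else 0ℝ

  rational : (Fin m → Fin m → ℚ) → Fin m → Fin m → ℚ
  rational w u v = if crosses S u v then w u v else 0ℚ

  if-affine : ∀ b {x y z} → seq x n ≡ y ℚ.+ z ℚ.* c →
    seq (if b then x else 0ℝ) n ≡
    (if b then y else 0ℚ) ℚ.+ (if b then z else 0ℚ) ℚ.* c
  if-affine true  e = e
  if-affine false _ = 0≡0+0* c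

-- Serves two ends: a feasible set bounds `opt` from below, and a solution allowed by the update
-- rule lies in a finite list that can be searched exhaustively.
⊆⇒∈-subsetsOf : ∀ {m} {S T : Subset m} → S ⊆ T → S ∈ subsetsOf T
⊆⇒∈-subsetsOf {S = []}          {[]}          _ = here refl
⊆⇒∈-subsetsOf {S = outside ∷ S} {outside ∷ T} h = ∈-map⁺ _ (⊆⇒∈-subsetsOf (drop-∷-⊆ h))
⊆⇒∈-subsetsOf {S = inside ∷ S}  {outside ∷ T} h = contradiction (h here) λ ()
⊆⇒∈-subsetsOf {S = inside ∷ S}  {inside ∷ T}  h =
  ∈-++⁺ˡ (∈-map⁺ _ (⊆⇒∈-subsetsOf (drop-∷-⊆ h)))
⊆⇒∈-subsetsOf {S = outside ∷ S} {inside ∷ T}  h =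
  ∈-++⁺ʳ _ (∈-map⁺ _ (⊆⇒∈-subsetsOf (drop-∷-⊆ h)))

seq-≤-max : ∀ {X : Set} (f : X → ℝ) n {x} xs → x ∈ xs →
            seq (f x) n ℚ.≤ seq (foldr _⊔_ 0ℝ (map f xs)) n
seq-≤-max f n (x ∷ xs) (here refl) = ℚ.p≤p⊔q _ _
seq-≤-max f n (x ∷ xs) (there x∈)  = ℚ.≤-trans (seq-≤-max f n xs x∈) (ℚ.p≤q⊔p (seq (f x) n) _)

-- The hard instances

-- The shape of the graph is kept apart from the real weight of its light arcs, so that both bounds
-- share it and `unitCut` and `lightCut` compute.
data Arc : Set where
  absent unit light : Arc

arc : Fin 6 → Fin 6 → Arc
arc 0F 1F = unit
arc 1F 0F = unit
arc 0F 2F = light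
arc 1F 3F = light
arc 2F 0F = unit
arc 3F 1F = unit
arc 4F 0F = unit
arc 5F 1F = unit
arc _  _  = absent

0ℝ≤1ℝ : 0ℝ ≤ 1ℝ
0ℝ≤1ℝ = pointwise-≤ {0ℝ} {1ℝ} λ _ → ℚ.nonNegative⁻¹ 1ℚ

arcWeight : ℝ≥0 → Arc → Maybe ℝ≥0
arcWeight c absent = nothing
arcWeight c unit   = just (1ℝ , 0ℝ≤1ℝ)
arcWeight c light  = just c

hard : ℝ≥0 → Digraph 6
hard c u v = arcWeight c (arc u v)

isUnit isLight : Arc → ℚ
isUnit absent = 0ℚ
isUnit unit   = 1ℚ
isUnit light  = 0ℚ
isLight absent = 0ℚ
isLight unit   = 0ℚ
isLight light  = 1ℚ

unitCut lightCut : Subset 6 → ℚ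
unitCut  = cutℚ (λ u v → isUnit (arc u v))
lightCut = cutℚ (λ u v → isLight (arc u v))

seq-cut-hard : ∀ c n S →
  seq (cut (hard c) S) n ≡ unitCut S ℚ.+ lightCut S ℚ.* seq (proj₁ c) n
seq-cut-hard c n = seq-cut-affine (hard c)
  (λ u v → isUnit (arc u v)) (λ u v → isLight (arc u v)) n (seq (proj₁ c) n) (λ u v → arcWeight-affine (arc u v))
  where
  arcWeight-affine : ∀ x →
    seq (weight (arcWeight c x)) n ≡ isUnit x ℚ.+ isLight x ℚ.* seq (proj₁ c) n
  arcWeight-affine absent = 0≡0+0* (seq (proj₁ c) n)
  arcWeight-affine unit   = cong (1ℚ ℚ.+_) (sym (ℚ.*-zeroˡ (seq (proj₁ c) n)))
  arcWeight-affine light  = sym (trans (ℚ.+-identityˡ _) (ℚ.*-identityˡ _))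

input : ℝ≥0 → (us : List (Fin 6)) → Unique us → Instance
input c us distinct = record
  { nodes = 6 ; graph = hard c ; revealed = us ; distinct = distinct }

cut≤opt : (I : Instance) → let open Instance I in ∀ {T} → T ⊆ groundSet → ∀ n →
          seq (cut graph T) n ℚ.≤ seq opt n
cut≤opt I {T} h n =
  seq-≤-max (cut graph) n (subsetsOf groundSet) (⊆⇒∈-subsetsOf {S = T} {groundSet} h)
  where open Instance I

∪-monoˡ-⊆ : ∀ {m} {S T : Subset m} U → S ⊆ T → S ∪ U ⊆ T ∪ U
∪-monoˡ-⊆ {S = S} {T} U h x∈ = x∈p∪q⁺ (Sum.map₁ h (x∈p∪q⁻ S U x∈))

solution-pair : ∀ {a m} (A : DeterministicAlgorithm a) (G : Digraph m) u v →
  Unique (v ∷ u ∷ []) → solution A G (v ∷ u ∷ []) ⊆ (⊥ ∪ ⁅ u ⁆) ∪ ⁅ v ⁆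
solution-pair A G u v distinct@(_ AllPairs.∷ distinct′) x∈ =
  ∪-monoˡ-⊆ ⁅ v ⁆ single (update G v (u ∷ []) distinct x∈)
  where
  open DeterministicAlgorithm A using (initial; update)
  single : solution A G (u ∷ []) ⊆ ⊥ ∪ ⁅ u ⁆
  single x∈ = subst (λ S → _ ∈ˢ S ∪ ⁅ u ⁆) (initial G) (update G u [] distinct′ x∈)

-- Randomized algorithms

module _ {a} (A : RandomizedAlgorithm a) where
  open RandomizedAlgorithm A
  open ProbabilitySpace space
  open Expectation space

  outcome : ∀ {m} → Digraph m → (Subset m → ℚ) → List (Fin m) → Subset m → Event × ℚ
  outcome G q us S = outputs G us S , q S

  outcomes : ∀ {m} → Digraph m → (Subset m → ℚ) → List (Fin m) → Simple
  outcomes G q us = map (outcome G q us) (subsetsOf ⊤)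

  outcomes-measurable : ∀ {m} (G : Digraph m) q us → Unique us → AllMeasurable (outcomes G q us)
  outcomes-measurable G q us distinct =
    All.map⁺ (All.universal (λ S → run-measurable G us distinct S) (subsetsOf ⊤))

  -- Each `ω` lies in exactly one of the events `outputs G us S`.
  value-outcomes : ∀ {m} (G : Digraph m) q us ω →
                   value (outcomes G q us) ω ≡ q (solution (run ω) G us)
  value-outcomes G q us ω =
    trans (cong Σℚ (sym (map-∘ {g = termValue ω} {outcome G q us} (subsetsOf ⊤))))
      (Σℚ-indicator q (solution (run ω) G us))

  -- Simple functions have rational coefficients, hence the hypothesis that cut values are rational
  -- constants; the hard graph with light weight zero meets it.
  expectedValue-≤-∫ : ∀ {m} (G : Digraph m) q us → Unique us → (∀ S n → seq (cut G S) n ≡ q S) →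
                      expectedValue G us ≤ ∫ everything (outcomes G q us)
  expectedValue-≤-∫ {m} G q us distinct eq =
    begin
    expectedValue G us
      ≲⟨ sum-map-mono-≤ (λ S → P (outputs G us S) * cut G S)
           (λ S → ∫term everything (outcome G q us S)) (subsetsOf ⊤) term ⟩
    sum (map (λ S → ∫term everything (outcome G q us S)) (subsetsOf ⊤))
      ≈⟨ pointwise-≈ {sum (map (λ S → ∫term everything (outcome G q us S)) (subsetsOf ⊤))}
           {∫ everything (outcomes G q us)}
           (λ n → cong (λ xs → seq (sum xs) n)
             (map-∘ {g = ∫term everything} {outcome G q us} (subsetsOf ⊤))) ⟩
    ∫ everything (outcomes G q us) ∎
    where
    open ≤-Reasoning
    term : ∀ S → P (outputs G us S) * cut G S ≤ ∫term everything (outcome G q us S)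
    term S = begin
      P O * cut G S
        ≈⟨ pointwise-≈ {P O * cut G S} {fromℚ (q S) * P O} (λ n →
             trans (cong (seq (P O) n ℚ.*_) (eq S n)) (ℚ.*-comm (seq (P O) n) (q S))) ⟩
      fromℚ (q S) * P O
        ≲⟨ scale-P-≤-∫term (q S) (run-measurable G us distinct S) ⟩
      ∫term everything (outcome G q us S) ∎
      where
      O : Event
      O = outputs G us S

  -- The three inputs are faced with the same `ω`, so their simple functions are concatenated and
  -- bounded pointwise: it suffices that each deterministic algorithm `run ω` obeys the bound.
  expectedValue-≤ : ∀ {m} (G : Digraph m) q → (∀ S n → seq (cut G S) n ≡ q S) →
    ∀ us vs ws → Unique us → Unique vs → Unique ws → ∀ k →
    (∀ ω → q (solution (run ω) G us) ℚ.+ (q (solution (run ω) G vs) ℚ.+ q (solution (run ω) G ws))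
             ℚ.≤ k) →
    expectedValue G us + (expectedValue G vs + expectedValue G ws) ≤ fromℚ k
  expectedValue-≤ G q eq us vs ws hus hvs hws k h = begin
    expectedValue G us + (expectedValue G vs + expectedValue G ws)
      ≲⟨ +-mono-≤ {expectedValue G us} {∫ everything U}
           {expectedValue G vs + expectedValue G ws} {∫ everything V + ∫ everything W}
           (expectedValue-≤-∫ G q us hus eq)
           (+-mono-≤ {expectedValue G vs} {∫ everything V} {expectedValue G ws} {∫ everything W}
             (expectedValue-≤-∫ G q vs hvs eq) (expectedValue-≤-∫ G q ws hws eq)) ⟩
    ∫ everything U + (∫ everything V + ∫ everything W)
      ≈⟨ pointwise-≈ {∫ everything U + (∫ everything V + ∫ everything W)} {∫ everything (U ++ V ++ W)}
           (λ n → sym (trans (seq-∫-++ everything n U (V ++ W))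
                             (cong (seq (∫ everything U) n ℚ.+_) (seq-∫-++ everything n V W)))) ⟩
    ∫ everything (U ++ V ++ W)
      ≲⟨ ∫-≤ {everything} (U ++ V ++ W) k measurable-Ω
           (All.++⁺ (outcomes-measurable G q us hus)
             (All.++⁺ (outcomes-measurable G q vs hvs) (outcomes-measurable G q ws hws)))
           (λ ω _ → subst (ℚ._≤ k) (sym (value-UVW ω)) (h ω)) ⟩
    fromℚ k * P everything
      ≲⟨ proj₁ (scale-cong k {P everything} {1ℝ} P-Ω) ⟩
    fromℚ k * 1ℝ
      ≈⟨ pointwise-≈ {fromℚ k * 1ℝ} {fromℚ k} (λ _ → ℚ.*-identityʳ k) ⟩
    fromℚ k ∎
    where
    open ≤-Reasoning
    U V W : Simple
    U = outcomes G q us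
    V = outcomes G q vs
    W = outcomes G q ws

    value-UVW : ∀ ω → value (U ++ V ++ W) ω ≡
      q (solution (run ω) G us) ℚ.+ (q (solution (run ω) G vs) ℚ.+ q (solution (run ω) G ws))
    value-UVW ω = trans (value-++ U (V ++ W) ω) (cong₂ ℚ._+_ (value-outcomes G q us ω)
      (trans (value-++ V W ω) (cong₂ ℚ._+_ (value-outcomes G q vs ω) (value-outcomes G q ws ω))))

-- The concrete inputs, and the bound 4/5 for randomized algorithms.

zeroWeight : ℝ≥0
zeroWeight = 0ℝ , ≤-refl {0ℝ}

seq-cut-hard-zero : ∀ S n → seq (cut (hard zeroWeight) S) n ≡ unitCut S
seq-cut-hard-zero S n = trans (seq-cut-hard zeroWeight n S)
  (trans (cong (unitCut S ℚ.+_) (ℚ.*-zeroʳ (lightCut S))) (ℚ.+-identityʳ (unitCut S)))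

us₀₁ us₀₁₂ us₀₁₃ us₀₁₂₄ us₀₁₃₅ : List (Fin 6)
us₀₁   = 1F ∷ 0F ∷ []
us₀₁₂  = 2F ∷ us₀₁
us₀₁₃  = 3F ∷ us₀₁
us₀₁₂₄ = 4F ∷ us₀₁₂
us₀₁₃₅ = 5F ∷ us₀₁₃

distinct₀₁ : Unique us₀₁
distinct₀₁ = from-yes (unique? us₀₁)

distinct₀₁₂ : Unique us₀₁₂
distinct₀₁₂ = from-yes (unique? us₀₁₂)

distinct₀₁₃ : Unique us₀₁₃
distinct₀₁₃ = from-yes (unique? us₀₁₃)

distinct₀₁₂₄ : Unique us₀₁₂₄
distinct₀₁₂₄ = from-yes (unique? us₀₁₂₄)

distinct₀₁₃₅ : Unique us₀₁₃₅
distinct₀₁₃₅ = from-yes (unique? us₀₁₃₅)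

-- Keeping 1 pays when 2 comes next, keeping 0 when 3 does, and keeping exactly
-- one of them when the input stops.
unitCut-trade-off : All (λ S → All (λ S₂ → All (λ S₃ →
    unitCut S ℚ.+ (unitCut S₂ ℚ.+ unitCut S₃) ℚ.≤ q4)
    (subsetsOf (S ∪ ⁅ 3F ⁆))) (subsetsOf (S ∪ ⁅ 2F ⁆))) (subsetsOf (⁅ 0F ⁆ ∪ ⁅ 1F ⁆))
unitCut-trade-off =
  from-yes (All.all? (λ S → All.all? (λ S₂ → All.all? (λ S₃ →
    unitCut S ℚ.+ (unitCut S₂ ℚ.+ unitCut S₃) ℚ.≤? q4)
    (subsetsOf (S ∪ ⁅ 3F ⁆))) (subsetsOf (S ∪ ⁅ 2F ⁆))) (subsetsOf (⁅ 0F ⁆ ∪ ⁅ 1F ⁆)))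

affineCut : Subset 6 → ℚ → ℚ
affineCut S c = unitCut S ℚ.+ lightCut S ℚ.* c

affineCut≤opt : ∀ c us distinct T → let open Instance (input c us distinct) in
  {True (T ⊆? groundSet)} → ∀ n → affineCut T (seq (proj₁ c) n) ℚ.≤ seq opt n
affineCut≤opt c us distinct T {h} n =
  subst (ℚ._≤ seq (Instance.opt (input c us distinct)) n) (seq-cut-hard c n T)
    (cut≤opt (input c us distinct) {T} (toWitness h) n)

-- Both numerical arguments end here: a sum of nonnegative slacks simplifies to a negative multiple
-- of `ε`.
¬0≤-k*ε : ∀ k {ε} .{{_ : ℚ.Positive k}} → 0ℚ ℚ.< ε → ¬ 0ℚ ℚ.≤ ℚ.- (k ℚ.* ε)
¬0≤-k*ε k {ε} 0<ε h = ℚ.<-irrefl refl (ℚ.<-≤-trans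
  (subst (ℚ._< k ℚ.* ε) (ℚ.*-zeroʳ k) (ℚ.*-monoʳ-<-pos k 0<ε))
  (subst (ℚ._≤ 0ℚ) (solve 1 (λ x → :- (:- x) := x) refl (k ℚ.* ε)) (ℚ.neg-antimono-≤ h)))

-- The optima add up to at least `5`, so the guaranteed values add up to at least
-- `5 (4/5 + ε) = 4 + 5 ε`, which exceeds `4 + ε` by `4 ε`.
randomized-arithmetic : ∀ {ε a o₁ o₂ o₃} → 0ℚ ℚ.< ε → q4/5 ℚ.+ ε ℚ.≤ a →
  1ℚ ℚ.≤ o₁ → q2 ℚ.≤ o₂ → q2 ℚ.≤ o₃ →
  ¬ a ℚ.* o₁ ℚ.+ (a ℚ.* o₂ ℚ.+ a ℚ.* o₃) ℚ.≤ q4 ℚ.+ ε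
randomized-arithmetic {ε} {a} {o₁} {o₂} {o₃} 0<ε ha h₁ h₂ h₃ h =
  ¬0≤-k*ε q4 0<ε (subst (0ℚ ℚ.≤_)
    (solve 5 (λ e a x y z →
        ((con q4 :+ e) :- (a :* x :+ (a :* y :+ a :* z)))
        :+ ((a :* (x :- con 1ℚ) :+ (a :* (y :- con q2) :+ a :* (z :- con q2)))
        :+ con q5 :* (a :- (con q4/5 :+ e)))
        := :- (con q4 :* e))
      refl ε a o₁ o₂ o₃)
    (0≤+ (0≤b-a h)
      (0≤+ (0≤+ (0≤* 0≤a (0≤b-a h₁)) (0≤+ (0≤* 0≤a (0≤b-a h₂)) (0≤* 0≤a (0≤b-a h₃))))
        (0≤* (ℚ.nonNegative⁻¹ q5) (0≤b-a ha)))))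
  where
  0≤a : 0ℚ ℚ.≤ a
  0≤a = ℚ.≤-trans (0≤+ (ℚ.nonNegative⁻¹ q4/5) (ℚ.<⇒≤ 0<ε)) ha

randomized-≤-4/5 : ∀ {a} (A : RandomizedAlgorithm a) α → 4/5 < α → ¬ CompetitiveRandomized α A
randomized-≤-4/5 A α (ε , 0<ε , M , hα) competitive =
  randomized-arithmetic 0<ε (hα n (ℕ.m≤m⊔n M N))
    (affineCut≤opt zeroWeight us₀₁ distinct₀₁ ⁅ 0F ⁆ n)
    (affineCut≤opt zeroWeight us₀₁₂ distinct₀₁₂ (⁅ 1F ⁆ ∪ ⁅ 2F ⁆) n)
    (affineCut≤opt zeroWeight us₀₁₃ distinct₀₁₃ (⁅ 0F ⁆ ∪ ⁅ 3F ⁆) n)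
    (proj₂ bounded n (ℕ.m≤n⊔m M N))
  where
  open RandomizedAlgorithm A using (run; expectedValue)

  G : Digraph 6
  G = hard zeroWeight

  I I₂ I₃ : Instance
  I  = input zeroWeight us₀₁ distinct₀₁
  I₂ = input zeroWeight us₀₁₂ distinct₀₁₂
  I₃ = input zeroWeight us₀₁₃ distinct₀₁₃

  trade-off : ∀ ω → unitCut (solution (run ω) G us₀₁) ℚ.+
    (unitCut (solution (run ω) G us₀₁₂) ℚ.+ unitCut (solution (run ω) G us₀₁₃)) ℚ.≤ q4
  -- Both continuations extend the same solution for `us₀₁`, so the lookups nest.
  trade-off ω = All.lookup (All.lookup (All.lookup unitCut-trade-off
      (⊆⇒∈-subsetsOf (solution-pair (run ω) G 0F 1F distinct₀₁)))
      (⊆⇒∈-subsetsOf (update G 2F us₀₁ distinct₀₁₂)))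
      (⊆⇒∈-subsetsOf (update G 3F us₀₁ distinct₀₁₃))
    where open DeterministicAlgorithm (run ω) using (update)

  total : α * Instance.opt I + (α * Instance.opt I₂ + α * Instance.opt I₃) ≤ fromℚ q4
  total = ≤-trans {α * Instance.opt I + (α * Instance.opt I₂ + α * Instance.opt I₃)}
    {expectedValue G us₀₁ + (expectedValue G us₀₁₂ + expectedValue G us₀₁₃)} {fromℚ q4}
    (+-mono-≤ {α * Instance.opt I} {expectedValue G us₀₁}
      {α * Instance.opt I₂ + α * Instance.opt I₃} {expectedValue G us₀₁₂ + expectedValue G us₀₁₃}
      (competitive I)
      (+-mono-≤ {α * Instance.opt I₂} {expectedValue G us₀₁₂}
        {α * Instance.opt I₃} {expectedValue G us₀₁₃} (competitive I₂) (competitive I₃)))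
    (expectedValue-≤ A G unitCut seq-cut-hard-zero us₀₁ us₀₁₂ us₀₁₃
      distinct₀₁ distinct₀₁₂ distinct₀₁₃ q4 trade-off)

  bounded : ∃[ N ] (∀ n → N ℕ.≤ n →
    seq (α * Instance.opt I + (α * Instance.opt I₂ + α * Instance.opt I₃)) n ℚ.≤ q4 ℚ.+ ε)
  bounded = total ε 0<ε

  N n : ℕ
  N = proj₁ bounded
  -- Late enough for the strict bound on `α` and for the bound on the total; the bounds on the
  -- optima hold at every index.
  n = M ℕ.⊔ N

-- Deterministic algorithms

-- For the iteration step `s` from `x`, `s - 4 = (5 - x)(x - 3)/8` and `5 - s = ((x - 4)² + 7)/8`.
√17-bounds : ∀ n → q4 ℚ.≤ seq √17 n × seq √17 n ℚ.≤ q5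
√17-bounds zero    = ℚ.≤-refl , from-yes (q4 ℚ.≤? q5)
√17-bounds (suc n) =
  let (l , u) = √17-bounds n in
    0≤b-a⇒a≤b (subst (0ℚ ℚ.≤_)
      (solve 1 (λ x → con ⅛ :* ((con q5 :- x) :* ((x :- con q4) :+ con 1ℚ))
        := (x :+ con ⅛ :* (con q17 :- x :* x)) :- con q4) refl (seq √17 n))
      (0≤* (ℚ.nonNegative⁻¹ ⅛) (0≤* (0≤b-a u) (0≤+ (0≤b-a l) (ℚ.nonNegative⁻¹ 1ℚ)))))
  , 0≤b-a⇒a≤b (subst (0ℚ ℚ.≤_)
      (solve 1 (λ x → con ⅛ :* ((x :- con q4) :* (x :- con q4) :+ con q7)
        := con q5 :- (x :+ con ⅛ :* (con q17 :- x :* x))) refl (seq √17 n))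
      (0≤* (ℚ.nonNegative⁻¹ ⅛) (0≤+ (0≤* (0≤b-a l) (0≤b-a l)) (ℚ.nonNegative⁻¹ q7))))
  where
  q7 : ℚ
  q7 = ℤ.+ 7 ℚ./ 1

-- The factor `ℚ.- 1ℚ`, here and in `ratioAt`, mirrors subtraction on `ℝ`, so that at `seq √17 n`
-- these are by computation the terms of the light weight and of `[5-√17]/2`.
lightAt : ℚ → ℚ
lightAt t = ¼ ℚ.* (t ℚ.+ (ℚ.- 1ℚ) ℚ.* q3)

ratioAt : ℚ → ℚ
ratioAt t = ½ ℚ.* (q5 ℚ.+ (ℚ.- 1ℚ) ℚ.* t)

0≤lightAt : ∀ {t} → q4 ℚ.≤ t → 0ℚ ℚ.≤ lightAt t
0≤lightAt {t} h = subst (0ℚ ℚ.≤_)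
  (solve 1 (λ t → con ¼ :* ((t :- con q4) :+ con 1ℚ) := con ¼ :* (t :+ con (ℚ.- 1ℚ) :* con q3))
    refl t)
  (0≤* (ℚ.nonNegative⁻¹ ¼) (0≤+ (0≤b-a h) (ℚ.nonNegative⁻¹ 1ℚ)))

opaque
  -- Opaque, so that the concrete checks on the graph do not unfold real arithmetic; later proofs
  -- reach its terms through `seq-lightWeight`.
  lightWeight : ℝ≥0
  lightWeight = fromℚ ¼ * (√17 - fromℚ q3)
              , pointwise-≤ {0ℝ} {fromℚ ¼ * (√17 - fromℚ q3)} (λ n → 0≤lightAt (proj₁ (√17-bounds n)))

  seq-lightWeight : ∀ n → seq (proj₁ lightWeight) n ≡ lightAt (seq √17 n)
  seq-lightWeight n = refl

-- A solution of value v = a + b c is too poor if p + q c is attainable, where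
-- c = (t - 3) / 4 and t approximates √17 with error controlled by e.
Beaten : ℚ → ℚ → ℚ → ℚ → Set
Beaten a b p q = ∀ t e → q4 ℚ.≤ t → t ℚ.≤ q5 → 0ℚ ℚ.≤ e → t ℚ.* t ℚ.≤ q17 ℚ.+ e →
  let v = a ℚ.+ b ℚ.* lightAt t
      o = p ℚ.+ q ℚ.* lightAt t
  in 1ℚ ℚ.≤ o × v ℚ.≤ ratioAt t ℚ.* o ℚ.+ ¼ ℚ.* e

-- Since `lightAt t` is nonnegative, one comparison settles every solution with smaller
-- coefficients.
Beaten-weaken : ∀ {a b a′ b′ p q} → Beaten a′ b′ p q → a ℚ.≤ a′ → b ℚ.≤ b′ → Beaten a b p q
Beaten-weaken {a} {b} {a′} {b′} beaten ha hb t e lo hi 0≤e h =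
  let (1≤o , v≤) = beaten t e lo hi 0≤e h in
  1≤o , ℚ.≤-trans (ℚ.+-mono-≤ ha
    (ℚ.*-monoʳ-≤-nonNeg (lightAt t) {{ℚ.nonNegative (0≤lightAt lo)}} hb)) v≤

1≤p+qc : ∀ {p q t} → 1ℚ ℚ.≤ p → 0ℚ ℚ.≤ q → q4 ℚ.≤ t → 1ℚ ℚ.≤ p ℚ.+ q ℚ.* lightAt t
1≤p+qc hp hq h = ℚ.≤-trans hp (a≤a+b (0≤* hq (0≤lightAt h)))

-- Apart from the error term, the right side minus the left is exactly `(17 - t²)/8`, which vanishes
-- at `√17`.
Beaten-both : Beaten 0ℚ q2 1ℚ 1ℚ
Beaten-both t e lo hi 0≤e h =
    1≤p+qc {1ℚ} ℚ.≤-refl (ℚ.nonNegative⁻¹ 1ℚ) lo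
  , 0≤b-a⇒a≤b (subst (0ℚ ℚ.≤_)
      (solve 2 (λ t e → con ⅛ :* ((con q17 :+ e) :- t :* t) :+ con ⅛ :* e
        := ((con ½ :* (con q5 :+ con (ℚ.- 1ℚ) :* t))
              :* (con 1ℚ :+ con 1ℚ :* (con ¼ :* (t :+ con (ℚ.- 1ℚ) :* con q3))) :+ con ¼ :* e)
           :- (con 0ℚ :+ con q2 :* (con ¼ :* (t :+ con (ℚ.- 1ℚ) :* con q3)))) refl t e)
      (0≤+ (0≤* (ℚ.nonNegative⁻¹ ⅛) (0≤b-a h)) (0≤* (ℚ.nonNegative⁻¹ ⅛) 0≤e)))

-- The difference is again `(17 - t²)/8`: the choice of `c` makes both cases tight.
Beaten-one : Beaten 1ℚ 0ℚ q2 1ℚ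
Beaten-one t e lo hi 0≤e h =
    1≤p+qc {q2} (from-yes (1ℚ ℚ.≤? q2)) (ℚ.nonNegative⁻¹ 1ℚ) lo
  , 0≤b-a⇒a≤b (subst (0ℚ ℚ.≤_)
      (solve 2 (λ t e → con ⅛ :* ((con q17 :+ e) :- t :* t) :+ con ⅛ :* e
        := ((con ½ :* (con q5 :+ con (ℚ.- 1ℚ) :* t))
              :* (con q2 :+ con 1ℚ :* (con ¼ :* (t :+ con (ℚ.- 1ℚ) :* con q3))) :+ con ¼ :* e)
           :- (con 1ℚ :+ con 0ℚ :* (con ¼ :* (t :+ con (ℚ.- 1ℚ) :* con q3)))) refl t e)
      (0≤+ (0≤* (ℚ.nonNegative⁻¹ ⅛) (0≤b-a h)) (0≤* (ℚ.nonNegative⁻¹ ⅛) 0≤e)))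

-- The tangent bound t ≤ (t² + 16) / 8 makes the linear term quadratic.
Beaten-last : Beaten 1ℚ 1ℚ q3 1ℚ
Beaten-last t e lo hi 0≤e h =
    1≤p+qc {q3} (from-yes (1ℚ ℚ.≤? q3)) (ℚ.nonNegative⁻¹ 1ℚ) lo
  , 0≤b-a⇒a≤b (subst (0ℚ ℚ.≤_)
      (solve 2 (λ t e → con (n/32 7) :* ((con q17 :+ e) :- t :* t)
            :+ (con (n/32 1) :* e :+ (con (n/32 5) :+ con (n/32 3) :* ((t :- con q4) :* (t :- con q4))))
        := ((con ½ :* (con q5 :+ con (ℚ.- 1ℚ) :* t))
              :* (con q3 :+ con 1ℚ :* (con ¼ :* (t :+ con (ℚ.- 1ℚ) :* con q3))) :+ con ¼ :* e)
           :- (con 1ℚ :+ con 1ℚ :* (con ¼ :* (t :+ con (ℚ.- 1ℚ) :* con q3)))) refl t e)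
      (0≤+ (0≤* (ℚ.nonNegative⁻¹ (n/32 7)) (0≤b-a h))
        (0≤+ (0≤* (ℚ.nonNegative⁻¹ (n/32 1)) 0≤e) (0≤+ (ℚ.nonNegative⁻¹ (n/32 5))
          (0≤* (ℚ.nonNegative⁻¹ (n/32 3)) (0≤* (0≤b-a lo) (0≤b-a lo)))))))
  where
  n/32 : ℕ → ℚ
  n/32 n = ℤ.+ n ℚ./ 32

-- As the optimum is at least `1`, the excess of `a` over the ratio gains at least `ε`.
-- Competitiveness gives away `½ ε` and the approximation of `√17` gives away `¼ ε`, which leaves
-- `¼ ε`.
deterministic-arithmetic : ∀ {ε a o o′ v t} → 0ℚ ℚ.< ε → ratioAt t ℚ.+ ε ℚ.≤ a →
  a ℚ.* o′ ℚ.≤ v ℚ.+ ½ ℚ.* ε → t ℚ.≤ q5 → 1ℚ ℚ.≤ o → o ℚ.≤ o′ →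
  ¬ v ℚ.≤ ratioAt t ℚ.* o ℚ.+ ¼ ℚ.* ε
deterministic-arithmetic {ε} {a} {o} {o′} {v} {t} 0<ε ha hv t≤5 1≤o o≤o′ h =
  ¬0≤-k*ε ¼ 0<ε (subst (0ℚ ℚ.≤_)
    (solve 6 (λ e a o o′ v r →
        ((v :+ con ½ :* e) :- a :* o′) :+ (a :* (o′ :- o) :+ (o :* (a :- (r :+ e))
          :+ (e :* (o :- con 1ℚ) :+ ((r :* o :+ con ¼ :* e) :- v))))
        := :- (con ¼ :* e))
      refl ε a o o′ v (ratioAt t))
    (0≤+ (0≤b-a hv) (0≤+ (0≤* 0≤a (0≤b-a o≤o′)) (0≤+ (0≤* 0≤o (0≤b-a ha))
      (0≤+ (0≤* (ℚ.<⇒≤ 0<ε) (0≤b-a 1≤o)) (0≤b-a h))))))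
  where
  0≤ratio : 0ℚ ℚ.≤ ratioAt t
  0≤ratio = subst (0ℚ ℚ.≤_)
    (solve 1 (λ t → con ½ :* (con q5 :- t) := con ½ :* (con q5 :+ con (ℚ.- 1ℚ) :* t)) refl t)
    (0≤* (ℚ.nonNegative⁻¹ ½) (0≤b-a t≤5))

  0≤a : 0ℚ ℚ.≤ a
  0≤a = ℚ.≤-trans (0≤+ 0≤ratio (ℚ.<⇒≤ 0<ε)) ha

  0≤o : 0ℚ ℚ.≤ o
  0≤o = ℚ.≤-trans (ℚ.nonNegative⁻¹ 1ℚ) 1≤o

-- The adversary's strategy against a deterministic algorithm.

module _ {a} (A : DeterministicAlgorithm a) (α : ℝ) ([5-√17]/2<α : [5-√17]/2 < α)
         (competitive : CompetitiveDeterministic α A) where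

  -- The graph is fixed in advance and only the revealed sequence depends on the algorithm, so
  -- seeing all arcs does not help.
  G : Digraph 6
  G = hard lightWeight

  -- All limits are replaced by terms at one index, late enough for the strict bound on `α`, for the
  -- competitive inequality up to `½ ε`, and for `t² ≤ 17 + ε`.
  refute : ∀ us (distinct : Unique us) T → {True (T ⊆? Instance.groundSet (input lightWeight us distinct))} →
    Beaten (unitCut (solution A G us)) (lightCut (solution A G us)) (unitCut T) (lightCut T) → ⊥₀
  refute us distinct T {h} beaten =
    let (1≤o , v≤) = beaten t ε (proj₁ (√17-bounds n)) (proj₂ (√17-bounds n)) (ℚ.<⇒≤ 0<ε)
                       (proj₂ square n (ℕ.m≤n⇒m≤o⊔n M (ℕ.m≤n⊔m N K)))
    in deterministic-arithmetic {t = t} 0<ε (proj₂ (proj₂ (proj₂ [5-√17]/2<α)) n (ℕ.m≤m⊔n M (N ℕ.⊔ K)))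
         (subst (λ v → seq α n ℚ.* seq opt n ℚ.≤ v ℚ.+ ½ ℚ.* ε)
           (trans (seq-cut-hard lightWeight n S)
             (cong (λ c → unitCut S ℚ.+ lightCut S ℚ.* c) (seq-lightWeight n)))
           (proj₂ ratio n (ℕ.m≤n⇒m≤o⊔n M (ℕ.m≤m⊔n N K))))
         (proj₂ (√17-bounds n)) 1≤o
         (subst (λ c → affineCut T c ℚ.≤ seq opt n) (seq-lightWeight n)
           (affineCut≤opt lightWeight us distinct T {h} n))
         v≤
    where
    I : Instance
    I = input lightWeight us distinct

    open Instance I using (opt)

    S : Subset 6
    S = solution A G us

    ε : ℚ
    ε = proj₁ [5-√17]/2<α

    0<ε : 0ℚ ℚ.< ε
    0<ε = proj₁ (proj₂ [5-√17]/2<α)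

    ratio : ∃[ N ] (∀ n → N ℕ.≤ n → seq (α * opt) n ℚ.≤ seq (cut G S) n ℚ.+ ½ ℚ.* ε)
    ratio = competitive I (½ ℚ.* ε) (0<½* 0<ε)

    square : ∃[ N ] (∀ n → N ℕ.≤ n → seq √17 n ℚ.* seq √17 n ℚ.≤ q17 ℚ.+ ε)
    square = proj₁ √17² ε 0<ε

    M N K n : ℕ
    M = proj₁ (proj₂ (proj₂ [5-√17]/2<α))
    N = proj₁ ratio
    K = proj₁ square
    n = M ℕ.⊔ (N ℕ.⊔ K)

    t : ℚ
    t = seq √17 n

  next : ∀ {us} u {S} → Unique (u ∷ us) → solution A G us ≡ S →
         solution A G (u ∷ us) ∈ subsetsOf (S ∪ ⁅ u ⁆)
  next {us} u distinct refl = ⊆⇒∈-subsetsOf (DeterministicAlgorithm.update A G u us distinct)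

  -- In each use `S` is a concrete set, so evaluation discharges the bounds on its coefficients.
  lost : ∀ us (distinct : Unique us) T →
    {True (T ⊆? Instance.groundSet (input lightWeight us distinct))} →
    ∀ {S a b} → Beaten a b (unitCut T) (lightCut T) → solution A G us ≡ S →
    {True (unitCut S ℚ.≤? a)} → {True (lightCut S ℚ.≤? b)} → ⊥₀
  lost us distinct T {h} {S} {a} {b} beaten refl {ha} {hb} =
    refute us distinct T {h} (Beaten-weaken {unitCut S} {lightCut S} {a} {b} {unitCut T} {lightCut T}
      beaten (toWitness ha) (toWitness hb))

  -- Whether or not 4 is kept, the value is at most `1 + c`, whereas the nodes 1 and 2, already
  -- rejected, together with 4 cut three unit arcs into 0 and the light arc 1 → 3.
  keeping-0-and-not-2 : solution A G us₀₁₂₄ ∈ subsetsOf (⁅ 0F ⁆ ∪ ⁅ 4F ⁆) → ⊥₀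
  keeping-0-and-not-2 = λ where
      (here e)                         → lose e
      (there (here e))                 → lose e
      (there (there (here e)))         → lose e
      (there (there (there (here e)))) → lose e
    where
    lose : ∀ {S} → solution A G us₀₁₂₄ ≡ S →
           {True (unitCut S ℚ.≤? 1ℚ)} → {True (lightCut S ℚ.≤? 1ℚ)} → ⊥₀
    lose e {h} {k} = lost us₀₁₂₄ distinct₀₁₂₄ (⁅ 1F ⁆ ∪ ⁅ 2F ⁆ ∪ ⁅ 4F ⁆) Beaten-last e {h} {k}

  keeping-0 : solution A G us₀₁₂ ∈ subsetsOf (⁅ 0F ⁆ ∪ ⁅ 2F ⁆) → ⊥₀
  keeping-0 = λ where
      (here e)                         → lose e
      -- The solution `⁅ 0F ⁆` still cuts the light arc 0 → 2, so it is worth `1 + c` and is not yet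
      -- beaten.
      (there (here e))                 → keeping-0-and-not-2 (next 4F distinct₀₁₂₄ e)
      (there (there (here e)))         → lose e
      (there (there (there (here e)))) → lose e
    where
    lose : ∀ {S} → solution A G us₀₁₂ ≡ S →
           {True (unitCut S ℚ.≤? 1ℚ)} → {True (lightCut S ℚ.≤? 0ℚ)} → ⊥₀
    lose e {h} {k} = lost us₀₁₂ distinct₀₁₂ (⁅ 1F ⁆ ∪ ⁅ 2F ⁆) Beaten-one e {h} {k}

  -- Here and in `keeping-1`, the graph's symmetry exchanging 0, 2, 4 with 1, 3, 5 is used.
  keeping-1-and-not-3 : solution A G us₀₁₃₅ ∈ subsetsOf (⁅ 1F ⁆ ∪ ⁅ 5F ⁆) → ⊥₀
  keeping-1-and-not-3 = λ where
      (here e)                         → lose e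
      (there (here e))                 → lose e
      (there (there (here e)))         → lose e
      (there (there (there (here e)))) → lose e
    where
    lose : ∀ {S} → solution A G us₀₁₃₅ ≡ S →
           {True (unitCut S ℚ.≤? 1ℚ)} → {True (lightCut S ℚ.≤? 1ℚ)} → ⊥₀
    lose e {h} {k} = lost us₀₁₃₅ distinct₀₁₃₅ (⁅ 0F ⁆ ∪ ⁅ 3F ⁆ ∪ ⁅ 5F ⁆) Beaten-last e {h} {k}

  keeping-1 : solution A G us₀₁₃ ∈ subsetsOf (⁅ 1F ⁆ ∪ ⁅ 3F ⁆) → ⊥₀
  keeping-1 = λ where
      (here e)                         → lose e
      (there (here e))                 → keeping-1-and-not-3 (next 5F distinct₀₁₃₅ e)
      (there (there (here e)))         → lose e
      (there (there (there (here e)))) → lose e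
    where
    lose : ∀ {S} → solution A G us₀₁₃ ≡ S →
           {True (unitCut S ℚ.≤? 1ℚ)} → {True (lightCut S ℚ.≤? 0ℚ)} → ⊥₀
    lose e {h} {k} = lost us₀₁₃ distinct₀₁₃ (⁅ 0F ⁆ ∪ ⁅ 3F ⁆) Beaten-one e {h} {k}

  -- The list runs through both, only 0, only 1, neither. The outer cases lose at once, being worth
  -- at most `2 c` against `1 + c`; the inner ones are answered with a devaluer of the kept node.
  keeping-some : solution A G us₀₁ ∈ subsetsOf (⁅ 0F ⁆ ∪ ⁅ 1F ⁆) → ⊥₀
  keeping-some = λ where
      (here e)                         → lose e
      (there (here e))                 → keeping-0 (next 2F distinct₀₁₂ e)
      (there (there (here e)))         → keeping-1 (next 3F distinct₀₁₃ e)
      (there (there (there (here e)))) → lose e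
    where
    lose : ∀ {S} → solution A G us₀₁ ≡ S →
           {True (unitCut S ℚ.≤? 0ℚ)} → {True (lightCut S ℚ.≤? q2)} → ⊥₀
    lose e {h} {k} = lost us₀₁ distinct₀₁ ⁅ 0F ⁆ Beaten-both e {h} {k}

  not-competitive : ⊥₀
  not-competitive = keeping-some (⊆⇒∈-subsetsOf (solution-pair A G 0F 1F distinct₀₁))

theorem1p4 : ∀ (a : Access) →
    (∀ (A : RandomizedAlgorithm a) (α : ℝ) → 4/5 < α → ¬ CompetitiveRandomized α A)
    × (∀ (A : DeterministicAlgorithm a) (α : ℝ) → [5-√17]/2 < α → ¬ CompetitiveDeterministic α A)
theorem1p4 a = randomized-≤-4/5 , not-competitive
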